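{- Let $r\ge 1$, let $\mathbf m\in\mathcal M_r$ be a Motzkin path, and let $T'_{\mathbf m}$ be the transfer matrix of the compactified graph $\Gamma'_{\mathbf m}$. Write $T'_{\mathbf m}=N_{\mathbf m}+B_{\mathbf m}$ with $N_{\mathbf m}$ strictly lower triangular and $B_{\mathbf m}$ upper triangular. Let $\sigma_{\mathbf m}=(i_1,\dots,i_r)$ and $\tau_{\mathbf m}=(j_1,\dots,j_r)$. Then $$N_{\mathbf m}=I-(f_{i_1}f_{i_2}\cdots f_{i_r})^{ -1},\qquad B_{\mathbf m}=t\,(d_1d_2\cdots d_{r+1})\,(e_{j_1}e_{j_2}\cdots e_{j_r}).$$
   Context: Motzkin paths: $\mathcal M_r$ is the set of integer vectors $\mathbf m=(m_1,\dots,m_r)$ with $|m_\alpha-m_{\alpha+1}|\le 1$ for $1\le\alpha<r$ and $\min_\alpha m_\alpha=0$. A maximal ascending (resp. descending) segment of $\mathbf m$ is a maximal interval $[\alpha,\beta]\subset\{1,\dots,r\}$, $\beta>\alpha$, of consecutive indices with $m_{\alpha+j}=m_\alpha+j$ (resp. $m_{\alpha+j}=m_\alpha-j$) for $0\le j\le\beta-\alpha$. $Q$-system: $\{R_{\alpha,n}\}_{0\le\alpha\le r+1,n\in\mathbb Z}$ is the solution of $R_{\alpha,n+1}R_{\alpha,n-1}=R_{\alpha,n}^2+R_{\alpha+1,n}R_{\alpha-1,n}$ ($1\le\alpha\le r$), $R_{0,n}=R_{r+1,n}=1$, with initial data $R_{\alpha,0},R_{\alpha,1}$ ($1\le\alpha\le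 r$) independent indeterminates. Weights: put $\lambda_{\alpha,n}=R_{\alpha,n+1}/R_{\alpha,n}$ and $\mu_{\alpha,n}=R_{\alpha,n}/R_{\alpha-1,n}$. For $1\le \alpha\le r+1$, $y_{2\alpha-1}=\lambda_{\alpha,m_\alpha}/\lambda_{\alpha-1,m_{\alpha-1}}$; for $1\le\alpha\le r$, $y_{2\alpha}=\frac{\mu_{\alpha+1,m_\alpha+1}}{\mu_{\alpha,m_\alpha}}\,A_\alpha B_\alpha$, where $A_\alpha=\lambda_{\alpha+1,m_{\alpha+1}}/\lambda_{\alpha+1,m_\alpha}$ if $m_\alpha=m_{\alpha+1}+1$ and $A_\alpha=1$ otherwise, and $B_\alpha=\lambda_{\alpha-1,m_\alpha}/\lambda_{\alpha-1,m_{\alpha-1}}$ if $m_{\alpha-1}=m_\alpha+1$ and $B_\alpha=1$ otherwise. (Since $\lambda_{0,n}=\lambda_{r+1,n}=1$, the values of $m_0,m_{r+1}$ are irrelevant.) The compactified graph $\Gamma'_{\mathbf m}$ has vertices $1,\dots,r+1$; oriented edges $i\to i+1$ with weight $1$ and $i+1\to i$ with weight $t y_{2i}$ ($1\le i\le r$); loops $i\to i$ with weight $t y_{2i-1}$ ($1\le i\le r+1$). In addition: for every maximal descending segment $[\alpha,\alpha+i-1]$ of $\mathbf m$, $i\ge 2$, it has edges $\alpha+p\to\alpha+q$ for all $0\le q$, $q+2\le p\le i$, with weight $t\,\prod_{j=\alpha+q}^{\alpha+p-1}y_{2j}\big/\prod_{j=\alpha+q+1}^{\alpha+p-1}y_{2j-1}$;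 for every maximal ascending segment $[\alpha,\alpha+i-1]$, $i\ge2$, it has edges $\alpha+q\to\alpha+p$ for all $0\le q$, $q+2\le p\le i$, with weight $(-1)^{p-q-1}$. The transfer matrix $T'_{\mathbf m}$ is the $(r+1)\times(r+1)$ matrix whose $(b,a)$ entry (row $b$, column $a$) is the weight of the edge $a\to b$, or $0$ if there is none. Sequences: $\sigma_{\mathbf m}$ is obtained from the sequence $(r,r-1,\dots,1)$ by reversing, for each maximal ascending segment $[\alpha,\beta]$ of $\mathbf m$, the block $(\beta,\beta-1,\dots,\alpha)$ into $(\alpha,\alpha+1,\dots,\beta)$. $\tau_{\mathbf m}$ is obtained from $(r,r-1,\dots,1)$ in the same way using the maximal descending segments. For example, $\mathbf m=(2,1,2,2,2,1,0,0,1)$ gives $\sigma_{\mathbf m}=(8,9,7,6,5,4,2,3,1)$ and $\tau_{\mathbf m}=(9,8,5,6,7,4,3,1,2)$. Elementary matrices of size $(r+1)\times(r+1)$, with $E_{i,j}$ the matrix units: $f_i=I+E_{i+1,i}$ and $e_i=I+\frac{y_{2i}}{y_{2i-1}}E_{i,i+1}$ for $1\le i\le r$; $d_i=I+(y_{2i-1}-1)E_{i,i}$ for $1\le i\le r+1$. -}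

module Defs where

open import Level using (_⊔_)
open import Algebra.Apartness.Bundles using (HeytingCommutativeRing; HeytingField)
open import Algebra.Bundles using (CommutativeRing; CommutativeSemiring)
import Algebra.Apartness.Properties.HeytingCommutativeRing as HeytingProperties
import Algebra.Properties.CommutativeSemigroup as CommutativeSemigroupProperties
import Algebra.Properties.Monoid.Mult as MonoidMult
import Algebra.Properties.Monoid.Sum as MonoidSum
import Algebra.Properties.Semiring.Exp as SemiringExp
import Algebra.Properties.Semiring.Mult as SemiringMult
open import Data.Bool.Base using (if_then_else_; _∧_)
open import Data.Fin.Base using (Fin; zero; suc; toℕ; fromℕ; inject₁; _↑ˡ_; _↑ʳ_)
open import Data.Fin.Properties as Fin using (any?; all?; splitAt-↑ˡ; splitAt-↑ʳ)
open import Data.Fin.Relation.Unary.Top using (view; ‵fromℕ; ‵inj₁)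
open import Data.Integer.Base as ℤ using (ℤ; +_; -[1+_]; 0ℤ; 1ℤ; ∣_∣)
import Data.Integer.Properties as ℤ
open import Data.List.Base as List using (List; []; _∷_; _++_; allFin; cartesianProduct; drop; filter; reverse; take)
open import Data.List.Relation.Unary.Any using (Any; here; there)
open import Data.Nat.Base as ℕ using (ℕ; zero; suc; _∸_; _≤_; _<_)
import Data.Nat.Properties as ℕ
open import Data.Product.Base using (∃; _×_; _,_; proj₁; proj₂)
open import Data.Sum.Base using (_⊎_; inj₁; inj₂; [_,_]′)
open import Data.Vec.Functional as Vector using (Vector; head; tail; insertAt)
open import Relation.Binary.PropositionalEquality as ≡ using (_≡_; _≢_)
open import Relation.Nullary using (Dec; yes; no; does; contradiction)
open import Relation.Nullary.Decidable using (map′; _×-dec_; _⊎-dec_; _→-dec_)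

-- Indices start at 0: the path index or graph vertex α of the
-- mathematics is the element i of Fin r or Fin (suc r) with
-- α = toℕ i + 1.  The index 0 ≤ α ≤ r + 1 of R and λ is the element of
-- Fin (2 + r) with α = toℕ; thus, for i : Fin r standing for α, the
-- indices α - 1, α, α + 1 are inject₁ (inject₁ i), suc (inject₁ i) and
-- suc (suc i).

record MotzkinPath (r : ℕ) : Set where
  field
    height      : Vector ℤ r
    step        : ∀ i j → toℕ j ≡ suc (toℕ i) → ∣ height i ℤ.- height j ∣ ≤ 1
    nonNegative : ∀ i → 0ℤ ℤ.≤ height i
    attainsZero : ∃ λ i → height i ≡ 0ℤ

module _ {r : ℕ} (m : MotzkinPath r) where
  open MotzkinPath m

  Ascending Descending : Fin r → Fin r → Set
  Ascending α β = toℕ α < toℕ β ×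
    (∀ γ → toℕ α ≤ toℕ γ → toℕ γ ≤ toℕ β → height γ ≡ height α ℤ.+ + (toℕ γ ∸ toℕ α))
  Descending α β = toℕ α < toℕ β ×
    (∀ γ → toℕ α ≤ toℕ γ → toℕ γ ≤ toℕ β → height γ ≡ height α ℤ.- + (toℕ γ ∸ toℕ α))

  ascending? : ∀ α β → Dec (Ascending α β)
  ascending? α β = (toℕ α ℕ.<? toℕ β) ×-dec all? λ γ →
    (toℕ α ℕ.≤? toℕ γ) →-dec (toℕ γ ℕ.≤? toℕ β) →-dec (height γ ℤ.≟ _)

  descending? : ∀ α β → Dec (Descending α β)
  descending? α β = (toℕ α ℕ.<? toℕ β) ×-dec all? λ γ →
    (toℕ α ℕ.≤? toℕ γ) →-dec (toℕ γ ℕ.≤? toℕ β) →-dec (height γ ℤ.≟ _)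

-- Maximality of the interval [α , β] with respect to inclusion.
Maximal : ∀ {r} → (Fin r → Fin r → Set) → Fin r → Fin r → Set
Maximal P α β = P α β ×
  (∀ α′ β′ → P α′ β′ → toℕ α′ ≤ toℕ α → toℕ β ≤ toℕ β′ → α′ ≡ α × β′ ≡ β)

maximal? : ∀ {r} {P : Fin r → Fin r → Set} →
           (∀ α β → Dec (P α β)) → ∀ α β → Dec (Maximal P α β)
maximal? P? α β = P? α β ×-dec all? λ α′ → all? λ β′ →
  P? α′ β′ →-dec (toℕ α′ ℕ.≤? toℕ α) →-dec (toℕ β ℕ.≤? toℕ β′) →-dec
  ((α′ Fin.≟ α) ×-dec (β′ Fin.≟ β))

maximalSegments : ∀ {r} {P : Fin r → Fin r → Set} →
                  (∀ α β → Dec (P α β)) → List (Fin r × Fin r)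
maximalSegments {r} P? =
  filter (λ (α , β) → maximal? P? α β) (cartesianProduct (allFin r) (allFin r))

-- In the sequence (r , … , 1) the block (β , … , α) has r - β entries
-- before it.  Reversing other, disjoint blocks does not move it.
reverseBlock : ∀ {r} → Fin r × Fin r → List (Fin r) → List (Fin r)
reverseBlock {r} (α , β) xs =
  take start xs ++ reverse (take size (drop start xs)) ++ drop (start ℕ.+ size) xs
  where
  start = r ∸ suc (toℕ β)
  size  = suc (toℕ β ∸ toℕ α)

σ τ : ∀ {r} → MotzkinPath r → List (Fin r)
σ {r} m = List.foldr reverseBlock (reverse (allFin r)) (maximalSegments (ascending? m))
τ {r} m = List.foldr reverseBlock (reverse (allFin r)) (maximalSegments (descending? m))

-- The vertices are 1 , … , r + 1.  A pair of vertices is joined by at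
-- most one edge in each direction, as distinct maximal segments of the
-- same kind are disjoint.
data Edge {r} (m : MotzkinPath r) : (source target : Fin (suc r)) → Set where
  up   : ∀ i → Edge m (inject₁ i) (suc i)
  down : ∀ i → Edge m (suc i) (inject₁ i)
  loop : ∀ i → Edge m i i
  desc : ∀ {a b} α β → Maximal (Descending m) α β →
         toℕ α ≤ toℕ b → 2 ℕ.+ toℕ b ≤ toℕ a → toℕ a ≤ suc (toℕ β) → Edge m a b
  asc  : ∀ {a b} α β → Maximal (Ascending m) α β →
         toℕ α ≤ toℕ a → 2 ℕ.+ toℕ a ≤ toℕ b → toℕ b ≤ suc (toℕ β) → Edge m a b

edge? : ∀ {r} (m : MotzkinPath r) a b → Dec (Edge m a b)
edge? {r} m a b = map′ to from
  (any? (λ i → (inject₁ i Fin.≟ a) ×-dec (suc i Fin.≟ b)) ⊎-dec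
   any? (λ i → (suc i Fin.≟ a) ×-dec (inject₁ i Fin.≟ b)) ⊎-dec
   (a Fin.≟ b) ⊎-dec
   any? (λ α → any? (λ β → long? (maximal? (descending? m)) α β b a)) ⊎-dec
   any? (λ α → any? (λ β → long? (maximal? (ascending? m)) α β a b)))
  where
  Long : (Fin r → Fin r → Set) → (α β : Fin r) (low high : Fin (suc r)) → Set
  Long P α β low high =
    P α β × toℕ α ≤ toℕ low × 2 ℕ.+ toℕ low ≤ toℕ high × toℕ high ≤ suc (toℕ β)

  long? : ∀ {P} → (∀ α β → Dec (P α β)) → ∀ α β low high → Dec (Long P α β low high)
  long? P? α β low high =
    P? α β ×-dec (_ ℕ.≤? _) ×-dec (_ ℕ.≤? _) ×-dec (_ ℕ.≤? _)

  Shape : Fin (suc r) → Fin (suc r) → Set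
  Shape a b =
    (∃ λ i → inject₁ i ≡ a × suc i ≡ b) ⊎
    (∃ λ i → suc i ≡ a × inject₁ i ≡ b) ⊎
    (a ≡ b) ⊎
    (∃ λ α → ∃ λ β → Long (Maximal (Descending m)) α β b a) ⊎
    (∃ λ α → ∃ λ β → Long (Maximal (Ascending m)) α β a b)

  to : ∀ {a b} → Shape a b → Edge m a b
  to (inj₁ (i , ≡.refl , ≡.refl))                               = up i
  to (inj₂ (inj₁ (i , ≡.refl , ≡.refl)))                        = down i
  to (inj₂ (inj₂ (inj₁ ≡.refl)))                                = loop _
  to (inj₂ (inj₂ (inj₂ (inj₁ (α , β , max , p , q , s)))))      = desc α β max p q s
  to (inj₂ (inj₂ (inj₂ (inj₂ (α , β , max , p , q , s)))))      = asc α β max p q s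

  from : ∀ {a b} → Edge m a b → Shape a b
  from (up i)               = inj₁ (i , ≡.refl , ≡.refl)
  from (down i)             = inj₂ (inj₁ (i , ≡.refl , ≡.refl))
  from (loop i)             = inj₂ (inj₂ (inj₁ ≡.refl))
  from (desc α β max p q s) = inj₂ (inj₂ (inj₂ (inj₁ (α , β , max , p , q , s))))
  from (asc α β max p q s)  = inj₂ (inj₂ (inj₂ (inj₂ (α , β , max , p , q , s))))

-- Poly A n is A[x₁]…[xₙ] read from the inside out: the coefficient list
-- (constant term first) of a polynomial in the first variable, whose
-- coefficients are polynomials in the remaining ones.
Poly : Set → ℕ → Set
Poly A zero    = A
Poly A (suc n) = List (Poly A n)

NonZero : ∀ n → Poly ℤ n → Set
NonZero zero    c = c ≢ 0ℤ
NonZero (suc n) p = Any (NonZero n) p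

module Evaluation {c ℓ} (S : CommutativeSemiring c ℓ) where
  open CommutativeSemiring S

  evaluate : ∀ {A : Set} → (A → Carrier) → ∀ {n} → Poly A n → Vector Carrier n → Carrier
  evaluate κ {zero}  c ρ = κ c
  evaluate κ {suc n} p ρ =
    List.foldr (λ c rest → evaluate κ c (tail ρ) + head ρ * rest) 0# p

module _ {c ℓ₁ ℓ₂} (K : HeytingField c ℓ₁ ℓ₂) where
  open HeytingField K hiding (zero)
  open CommutativeRing (HeytingCommutativeRing.commutativeRing heytingCommutativeRing)
    using (+-monoid; commutativeSemiring)
  open MonoidMult +-monoid renaming (_×_ to _×ℕ_)
  open Evaluation commutativeSemiring

  fromℤ : ℤ → Carrier
  fromℤ (+ n)    = n ×ℕ 1#
  fromℤ -[1+ n ] = - (suc n ×ℕ 1#)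

  -- Stated with _#_ because this is the constructive meaning of a
  -- field element being nonzero.  Integer coefficients are the same as
  -- rational ones here; constant polynomials force characteristic 0.
  AlgebraicallyIndependent : ∀ {n} → Vector Carrier n → Set ℓ₂
  AlgebraicallyIndependent {n} x = ∀ p → NonZero n p → evaluate fromℤ p x # 0#

  -- A solution, in an arbitrary field, whose initial data are
  -- independent indeterminates; by R-nonzero below, the initial data
  -- determine it.
  record QSystem (r : ℕ) : Set (c ⊔ ℓ₁ ⊔ ℓ₂) where
    field
      R           : Fin (2 ℕ.+ r) → ℤ → Carrier
      R-first     : ∀ n → R zero n ≈ 1#
      R-last      : ∀ n → R (fromℕ (suc r)) n ≈ 1#
      relation    : ∀ (i : Fin r) n →
        R (suc (inject₁ i)) (ℤ.suc n) * R (suc (inject₁ i)) (ℤ.pred n) ≈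
        R (suc (inject₁ i)) n * R (suc (inject₁ i)) n +
        R (suc (suc i)) n * R (inject₁ (inject₁ i)) n
      independent : AlgebraicallyIndependent
        ((λ i → R (suc (inject₁ i)) 0ℤ) Vector.++ (λ i → R (suc (inject₁ i)) 1ℤ))

-- No R α n vanishes: it is a quotient of nonzero polynomials with
-- natural coefficients in the initial data.

0ₚ : ∀ n → Poly ℕ n
0ₚ zero    = 0
0ₚ (suc n) = []

1ₚ : ∀ n → Poly ℕ n
1ₚ zero    = 1
1ₚ (suc n) = 1ₚ n ∷ []

varₚ : ∀ {n} → Fin n → Poly ℕ n
varₚ {suc n} zero    = 0ₚ n ∷ 1ₚ n ∷ []
varₚ {suc n} (suc i) = varₚ i ∷ []

addₚ  : ∀ n → Poly ℕ n → Poly ℕ n → Poly ℕ n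
addₚ zero    a       b       = a ℕ.+ b
addₚ (suc n) []      q       = q
addₚ (suc n) (a ∷ p) []      = a ∷ p
addₚ (suc n) (a ∷ p) (b ∷ q) = addₚ n a b ∷ addₚ (suc n) p q

mulₚ   : ∀ n → Poly ℕ n → Poly ℕ n → Poly ℕ n
scaleₚ : ∀ n → Poly ℕ n → Poly ℕ (suc n) → Poly ℕ (suc n)
mulₚ zero    a       b = a ℕ.* b
mulₚ (suc n) []      q = []
mulₚ (suc n) (a ∷ p) q = addₚ (suc n) (scaleₚ n a q) (0ₚ n ∷ mulₚ (suc n) p q)
scaleₚ n a []      = []
scaleₚ n a (b ∷ q) = mulₚ n a b ∷ scaleₚ n a q

module EvaluationProperties {c ℓ} (S : CommutativeSemiring c ℓ) where
  open CommutativeSemiring S renaming (zero to *-zero)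
  open Evaluation S
  open SemiringMult semiring renaming (_×_ to _×ℕ_)
  open CommutativeSemigroupProperties +-commutativeSemigroup using () renaming (interchange to +-interchange)
  open CommutativeSemigroupProperties *-commutativeSemigroup using (x∙yz≈y∙xz)
  open import Relation.Binary.Reasoning.Setoid setoid

  ⟦_⟧ : ∀ {n} → Poly ℕ n → Vector Carrier n → Carrier
  ⟦_⟧ = evaluate (_×ℕ 1#)

  ⟦0ₚ⟧ : ∀ n ρ → ⟦ 0ₚ n ⟧ ρ ≈ 0#
  ⟦0ₚ⟧ zero    ρ = refl
  ⟦0ₚ⟧ (suc n) ρ = refl

  ⟦1ₚ⟧ : ∀ n ρ → ⟦ 1ₚ n ⟧ ρ ≈ 1#
  ⟦1ₚ⟧ zero    ρ = ×-homo-1 1#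
  ⟦1ₚ⟧ (suc n) ρ = begin
    ⟦ 1ₚ n ⟧ (tail ρ) + head ρ * 0# ≈⟨ +-cong (⟦1ₚ⟧ n (tail ρ)) (zeroʳ _) ⟩
    1# + 0#                         ≈⟨ +-identityʳ 1# ⟩
    1#                              ∎

  ⟦varₚ⟧ : ∀ {n} (i : Fin n) ρ → ⟦ varₚ i ⟧ ρ ≈ ρ i
  ⟦varₚ⟧ {suc n} zero ρ = begin
    ⟦ 0ₚ n ⟧ (tail ρ) + head ρ * ⟦ 1ₚ (suc n) ⟧ ρ
      ≈⟨ +-cong (⟦0ₚ⟧ n (tail ρ)) (*-congˡ (⟦1ₚ⟧ (suc n) ρ)) ⟩
    0# + head ρ * 1# ≈⟨ +-identityˡ _ ⟩
    head ρ * 1#      ≈⟨ *-identityʳ _ ⟩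
    head ρ           ∎
  ⟦varₚ⟧ {suc n} (suc i) ρ = begin
    ⟦ varₚ i ⟧ (tail ρ) + head ρ * 0# ≈⟨ +-cong (⟦varₚ⟧ i (tail ρ)) (zeroʳ _) ⟩
    ρ (suc i) + 0#                    ≈⟨ +-identityʳ _ ⟩
    ρ (suc i)                         ∎

  ⟦addₚ⟧ : ∀ n p q ρ → ⟦ addₚ n p q ⟧ ρ ≈ ⟦ p ⟧ ρ + ⟦ q ⟧ ρ
  ⟦addₚ⟧ zero    a       b       ρ = ×-homo-+ 1# a b
  ⟦addₚ⟧ (suc n) []      q       ρ = sym (+-identityˡ _)
  ⟦addₚ⟧ (suc n) (a ∷ p) []      ρ = sym (+-identityʳ _)
  ⟦addₚ⟧ (suc n) (a ∷ p) (b ∷ q) ρ = begin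
    ⟦ addₚ n a b ⟧ ρ′ + x * ⟦ addₚ (suc n) p q ⟧ ρ
      ≈⟨ +-cong (⟦addₚ⟧ n a b ρ′) (*-congˡ (⟦addₚ⟧ (suc n) p q ρ)) ⟩
    (⟦ a ⟧ ρ′ + ⟦ b ⟧ ρ′) + x * (⟦ p ⟧ ρ + ⟦ q ⟧ ρ)
      ≈⟨ +-congˡ (distribˡ x _ _) ⟩
    (⟦ a ⟧ ρ′ + ⟦ b ⟧ ρ′) + (x * ⟦ p ⟧ ρ + x * ⟦ q ⟧ ρ)
      ≈⟨ +-interchange _ _ _ _ ⟩
    (⟦ a ⟧ ρ′ + x * ⟦ p ⟧ ρ) + (⟦ b ⟧ ρ′ + x * ⟦ q ⟧ ρ) ∎
    where
    x  = head ρ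
    ρ′ = tail ρ

  ⟦mulₚ⟧   : ∀ n p q ρ → ⟦ mulₚ n p q ⟧ ρ ≈ ⟦ p ⟧ ρ * ⟦ q ⟧ ρ
  ⟦scaleₚ⟧ : ∀ n a q ρ → ⟦ scaleₚ n a q ⟧ ρ ≈ ⟦ a ⟧ (tail ρ) * ⟦ q ⟧ ρ
  ⟦mulₚ⟧ zero    a       b ρ = ×1-homo-* a b
  ⟦mulₚ⟧ (suc n) []      q ρ = sym (zeroˡ _)
  ⟦mulₚ⟧ (suc n) (a ∷ p) q ρ = begin
    ⟦ addₚ (suc n) (scaleₚ n a q) (0ₚ n ∷ mulₚ (suc n) p q) ⟧ ρ
      ≈⟨ ⟦addₚ⟧ (suc n) (scaleₚ n a q) (0ₚ n ∷ mulₚ (suc n) p q) ρ ⟩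
    ⟦ scaleₚ n a q ⟧ ρ + (⟦ 0ₚ n ⟧ ρ′ + x * ⟦ mulₚ (suc n) p q ⟧ ρ)
      ≈⟨ +-cong (⟦scaleₚ⟧ n a q ρ)
           (trans (+-cong (⟦0ₚ⟧ n ρ′) (*-congˡ (⟦mulₚ⟧ (suc n) p q ρ))) (+-identityˡ _)) ⟩
    ⟦ a ⟧ ρ′ * ⟦ q ⟧ ρ + x * (⟦ p ⟧ ρ * ⟦ q ⟧ ρ)
      ≈⟨ +-congˡ (*-assoc _ _ _) ⟨
    ⟦ a ⟧ ρ′ * ⟦ q ⟧ ρ + (x * ⟦ p ⟧ ρ) * ⟦ q ⟧ ρ
      ≈⟨ distribʳ _ _ _ ⟨
    (⟦ a ⟧ ρ′ + x * ⟦ p ⟧ ρ) * ⟦ q ⟧ ρ ∎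
    where
    x  = head ρ
    ρ′ = tail ρ
  ⟦scaleₚ⟧ n a []      ρ = sym (zeroʳ _)
  ⟦scaleₚ⟧ n a (b ∷ q) ρ = begin
    ⟦ mulₚ n a b ⟧ ρ′ + x * ⟦ scaleₚ n a q ⟧ ρ
      ≈⟨ +-cong (⟦mulₚ⟧ n a b ρ′) (*-congˡ (⟦scaleₚ⟧ n a q ρ)) ⟩
    ⟦ a ⟧ ρ′ * ⟦ b ⟧ ρ′ + x * (⟦ a ⟧ ρ′ * ⟦ q ⟧ ρ)
      ≈⟨ +-congˡ (x∙yz≈y∙xz _ _ _) ⟩
    ⟦ a ⟧ ρ′ * ⟦ b ⟧ ρ′ + ⟦ a ⟧ ρ′ * (x * ⟦ q ⟧ ρ)
      ≈⟨ distribˡ _ _ _ ⟨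
    ⟦ a ⟧ ρ′ * (⟦ b ⟧ ρ′ + x * ⟦ q ⟧ ρ) ∎
    where
    x  = head ρ
    ρ′ = tail ρ

module Naturals = EvaluationProperties ℕ.+-*-commutativeSemiring

-- The value at (1 , … , 1).
coefficientSum : ∀ {n} → Poly ℕ n → ℕ
coefficientSum p = Naturals.⟦ p ⟧ (λ _ → 1)

toPolyℤ : ∀ n → Poly ℕ n → Poly ℤ n
toPolyℤ zero    c = + c
toPolyℤ (suc n) p = List.map (toPolyℤ n) p

coefficientSum⇒nonZero : ∀ n p → coefficientSum {n} p ≢ 0 → NonZero n (toPolyℤ n p)
coefficientSum⇒nonZero zero    zero    ≢0 = contradiction ≡.refl ≢0
coefficientSum⇒nonZero zero    (suc c) ≢0 = λ ()
coefficientSum⇒nonZero (suc n) []      ≢0 = contradiction ≡.refl ≢0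
coefficientSum⇒nonZero (suc n) (a ∷ p) ≢0 with coefficientSum {n} a ℕ.≟ 0
... | no  a≢0 = here (coefficientSum⇒nonZero n a a≢0)
... | yes a≡0 = there (coefficientSum⇒nonZero (suc n) p
        λ p≡0 → ≢0 (≡.cong₂ (λ u v → u ℕ.+ 1 ℕ.* v) a≡0 p≡0))

module _ {c ℓ₁ ℓ₂} (K : HeytingField c ℓ₁ ℓ₂) {r : ℕ} (Q : QSystem K r) where
  open HeytingField K hiding (zero)
  open QSystem Q
  private
    commutativeRing = HeytingCommutativeRing.commutativeRing heytingCommutativeRing
  open CommutativeRing commutativeRing using (commutativeSemiring; *-commutativeSemigroup)
  open CommutativeSemigroupProperties *-commutativeSemigroup using (x∙yz≈y∙xz; interchange)
  open HeytingProperties heytingCommutativeRing using (#-congʳ; invertibleˡ⇒#; x-0≈x)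
  open Evaluation commutativeSemiring
  open EvaluationProperties commutativeSemiring
  open import Relation.Binary.Reasoning.Setoid setoid

  private
    v = r ℕ.+ r

    initial : Vector Carrier v
    initial = (λ i → R (suc (inject₁ i)) 0ℤ) Vector.++ (λ i → R (suc (inject₁ i)) 1ℤ)

    evaluate-toPolyℤ : ∀ n p ρ → evaluate (fromℤ K) (toPolyℤ n p) ρ ≈ ⟦ p ⟧ ρ
    evaluate-toPolyℤ zero    c       ρ = refl
    evaluate-toPolyℤ (suc n) []      ρ = refl
    evaluate-toPolyℤ (suc n) (a ∷ p) ρ =
      +-cong (evaluate-toPolyℤ n a (tail ρ)) (*-congˡ (evaluate-toPolyℤ (suc n) p ρ))

    record Polynomial (x : Carrier) : Set ℓ₁ where
      constructor polynomial
      field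
        poly     : Poly ℕ v
        positive : coefficientSum {v} poly ≢ 0
        value    : ⟦ poly ⟧ initial ≈ x

    polynomial-# : ∀ {x} → Polynomial x → x # 0#
    polynomial-# (polynomial p ≢0 p≈x) =
      #-congʳ (trans (evaluate-toPolyℤ v p initial) p≈x)
        (independent (toPolyℤ v p) (coefficientSum⇒nonZero v p ≢0))

    1-polynomial : Polynomial 1#
    1-polynomial = polynomial (1ₚ v)
      (λ eq → contradiction (≡.trans (≡.sym (Naturals.⟦1ₚ⟧ v _)) eq) λ ()) (⟦1ₚ⟧ v initial)

    var-polynomial : ∀ i → Polynomial (initial i)
    var-polynomial i = polynomial (varₚ i)
      (λ eq → contradiction (≡.trans (≡.sym (Naturals.⟦varₚ⟧ i _)) eq) λ ()) (⟦varₚ⟧ i initial)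

    +-polynomial : ∀ {x y} → Polynomial x → Polynomial y → Polynomial (x + y)
    +-polynomial (polynomial p p≢0 p≈x) (polynomial q _ q≈y) = polynomial (addₚ v p q)
      (λ eq → p≢0 (ℕ.m+n≡0⇒m≡0 _ (≡.trans (≡.sym (Naturals.⟦addₚ⟧ v p q _)) eq)))
      (trans (⟦addₚ⟧ v p q initial) (+-cong p≈x q≈y))

    *-polynomial : ∀ {x y} → Polynomial x → Polynomial y → Polynomial (x * y)
    *-polynomial (polynomial p p≢0 p≈x) (polynomial q q≢0 q≈y) = polynomial (mulₚ v p q)
      (λ eq → [ p≢0 , q≢0 ]′
        (ℕ.m*n≡0⇒m≡0∨n≡0 _ (≡.trans (≡.sym (Naturals.⟦mulₚ⟧ v p q _)) eq)))
      (trans (⟦mulₚ⟧ v p q initial) (*-cong p≈x q≈y))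

    record Quotient (x : Carrier) : Set (c ⊔ ℓ₁) where
      constructor quotient′
      field
        {num den} : Carrier
        num-poly  : Polynomial num
        den-poly  : Polynomial den
        value     : x * den ≈ num

    cong-quotient : ∀ {x y} → x ≈ y → Quotient x → Quotient y
    cong-quotient x≈y (quotient′ p q eq) = quotient′ p q (trans (*-congʳ (sym x≈y)) eq)

    polynomial⇒quotient : ∀ {x} → Polynomial x → Quotient x
    polynomial⇒quotient p = quotient′ p 1-polynomial (*-identityʳ _)

    *-quotient : ∀ {x y} → Quotient x → Quotient y → Quotient (x * y)
    *-quotient (quotient′ p q xq≈p) (quotient′ p′ q′ yq′≈p′) =
      quotient′ (*-polynomial p p′) (*-polynomial q q′)
        (trans (interchange _ _ _ _) (*-cong xq≈p yq′≈p′))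

    +-quotient : ∀ {x y} → Quotient x → Quotient y → Quotient (x + y)
    +-quotient {x} {y} (quotient′ {a} {b} p q xb≈a) (quotient′ {a′} {b′} p′ q′ yb′≈a′) =
      quotient′ (+-polynomial (*-polynomial p q′) (*-polynomial q p′)) (*-polynomial q q′) (begin
        (x + y) * (b * b′)             ≈⟨ distribʳ _ _ _ ⟩
        x * (b * b′) + y * (b * b′)    ≈⟨ +-cong (sym (*-assoc _ _ _)) (x∙yz≈y∙xz _ _ _) ⟩
        x * b * b′ + b * (y * b′)      ≈⟨ +-cong (*-congʳ xb≈a) (*-congˡ yb′≈a′) ⟩
        a * b′ + b * a′                ∎)

    /-quotient : ∀ {x y z} → x * y ≈ z → Quotient y → Quotient z → Quotient x
    /-quotient {x} {y} {z} xy≈z (quotient′ {a} {b} p q yb≈a) (quotient′ {a′} {b′} p′ q′ zb′≈a′) =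
      quotient′ (*-polynomial p′ q) (*-polynomial p q′) (begin
        x * (a * b′)       ≈⟨ *-congˡ (*-congʳ yb≈a) ⟨
        x * (y * b * b′)   ≈⟨ *-congˡ (*-assoc _ _ _) ⟩
        x * (y * (b * b′)) ≈⟨ *-assoc _ _ _ ⟨
        x * y * (b * b′)   ≈⟨ *-cong xy≈z (*-comm _ _) ⟩
        z * (b′ * b)       ≈⟨ *-assoc _ _ _ ⟨
        z * b′ * b         ≈⟨ *-congʳ zb′≈a′ ⟩
        a′ * b             ∎)

    quotient-# : ∀ {x} → Quotient x → x # 0#
    quotient-# {x} (quotient′ {a} {b} p _ xb≈a) with #⇒invertible (polynomial-# p)
    ... | a⁻¹ , a⁻¹a≈1 , _ = invertibleˡ⇒# (a⁻¹ * b , (begin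
      a⁻¹ * b * (x - 0#) ≈⟨ *-congˡ (x-0≈x x) ⟩
      a⁻¹ * b * x        ≈⟨ *-assoc _ _ _ ⟩
      a⁻¹ * (b * x)      ≈⟨ *-congˡ (trans (*-comm _ _) xb≈a) ⟩
      a⁻¹ * a            ≈⟨ *-congˡ (x-0≈x a) ⟨
      a⁻¹ * (a - 0#)     ≈⟨ a⁻¹a≈1 ⟩
      1#                 ∎))

    Column : ℤ → Set (c ⊔ ℓ₁)
    Column n = ∀ i → Quotient (R (suc (inject₁ i)) n)

    full : ∀ {n} → Column n → ∀ α → Quotient (R α n)
    full col zero    = cong-quotient (sym (R-first _)) (polynomial⇒quotient 1-polynomial)
    full col (suc j) with view j
    ... | ‵fromℕ          = cong-quotient (sym (R-last _)) (polynomial⇒quotient 1-polynomial)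
    ... | ‵inj₁ {i = i} _ = col i

    rhs : ∀ {n} → Column n → ∀ i → Quotient
      (R (suc (inject₁ i)) n * R (suc (inject₁ i)) n + R (suc (suc i)) n * R (inject₁ (inject₁ i)) n)
    rhs col i = +-quotient (*-quotient (col i) (col i))
      (*-quotient (full col (suc (suc i))) (full col (inject₁ (inject₁ i))))

    forward : ∀ n → Column (ℤ.pred n) → Column n → Column (ℤ.suc n)
    forward n prev col i = /-quotient (relation i n) (prev i) (rhs col i)

    backward : ∀ n → Column (ℤ.suc n) → Column n → Column (ℤ.pred n)
    backward n next col i =
      /-quotient (trans (*-comm _ _) (relation i n)) (next i) (rhs col i)

    column₀ : Column 0ℤ
    column₀ i = ≡.subst Quotient (≡.cong [ _ , _ ]′ (splitAt-↑ˡ r i r))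
      (polynomial⇒quotient (var-polynomial (i ↑ˡ r)))

    column₁ : Column 1ℤ
    column₁ i = ≡.subst Quotient (≡.cong [ _ , _ ]′ (splitAt-↑ʳ r r i))
      (polynomial⇒quotient (var-polynomial (r ↑ʳ i)))

    up-columns : ∀ k → Column (+ k) × Column (+ suc k)
    up-columns zero    = column₀ , column₁
    up-columns (suc k) with up-columns k
    ... | this , next = next , forward (+ suc k) this next

    down-columns : ∀ k → Column -[1+ k ] × Column (ℤ.suc -[1+ k ])
    down-columns zero    = backward 0ℤ column₁ column₀ , column₀
    down-columns (suc k) with down-columns k
    ... | this , next = backward -[1+ k ] next this , this

    column : ∀ n → Column n
    column (+ k)    = proj₁ (up-columns k)
    column -[1+ k ] = proj₁ (down-columns k)

  R-nonzero : ∀ α n → R α n # 0#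
  R-nonzero α n = quotient-# (full (column n) α)

module _ {c ℓ₁ ℓ₂} (K : HeytingField c ℓ₁ ℓ₂) where
  open HeytingField K hiding (zero)
  open CommutativeRing (HeytingCommutativeRing.commutativeRing heytingCommutativeRing)
    using (*-commutativeSemigroup)
  open CommutativeSemigroupProperties *-commutativeSemigroup using (interchange)
  open HeytingProperties heytingCommutativeRing using (x-0≈x)

  -- Nonzero elements together with their inverse, so that division is
  -- defined without a convention for dividing by zero.
  record Unit : Set (c ⊔ ℓ₁) where
    field
      val     : Carrier
      inv     : Carrier
      inverse : val * inv ≈ 1#
  open Unit

  #⇒unit : ∀ {x} → x # 0# → Unit
  #⇒unit {x} x#0 with #⇒invertible x#0
  ... | x⁻¹ , _ , xx⁻¹≈1 = record
    { val = x ; inv = x⁻¹ ; inverse = trans (*-congʳ (sym (x-0≈x x))) xx⁻¹≈1 }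

  infixl 7 _·_ _÷_

  1ᵘ : Unit
  1ᵘ = record { val = 1# ; inv = 1# ; inverse = *-identityˡ 1# }

  _·_ _÷_ : Unit → Unit → Unit
  u · w = record
    { val = val u * val w ; inv = inv u * inv w
    ; inverse = trans (interchange _ _ _ _)
        (trans (*-cong (inverse u) (inverse w)) (*-identityˡ 1#)) }
  u ÷ w = u · record
    { val = inv w ; inv = val w ; inverse = trans (*-comm _ _) (inverse w) }

  ∏ : ∀ {n} → (lo hi : ℕ) → Vector Unit n → Unit
  ∏ {n} lo hi u = List.foldr _·_ 1ᵘ
    (List.map u (filter (λ i → (lo ℕ.≤? toℕ i) ×-dec (toℕ i ℕ.<? hi)) (allFin n)))

  module Weights {r : ℕ} (Q : QSystem K r) (m : MotzkinPath r) where
    open MotzkinPath m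

    Rᵘ : Fin (2 ℕ.+ r) → ℤ → Unit
    Rᵘ α n = #⇒unit (R-nonzero K Q α n)

    λᵘ : Fin (2 ℕ.+ r) → ℤ → Unit
    λᵘ α n = Rᵘ α (ℤ.suc n) ÷ Rᵘ α n

    -- μᵘ j is μ_α for α = toℕ j + 1.
    μᵘ : Fin (suc r) → ℤ → Unit
    μᵘ j n = Rᵘ (suc j) n ÷ Rᵘ (inject₁ j) n

    -- m₀ = m_{r+1} = 0 by convention; the value is immaterial because
    -- λ₀ = λ_{r+1} = 1.
    extended : Vector ℤ (2 ℕ.+ r)
    extended = 0ℤ Vector.∷ insertAt height (fromℕ r) 0ℤ

    -- yOdd i is y_{2α-1} and yEven i is y_{2α}, where α = toℕ i + 1.
    yOdd : Vector Unit (suc r)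
    yOdd i = λᵘ (suc i) (extended (suc i)) ÷ λᵘ (inject₁ i) (extended (inject₁ i))

    yEven : Vector Unit r
    yEven i = μᵘ (suc i) (ℤ.suc (extended α)) ÷ μᵘ (inject₁ i) (extended α) · A · B
      where
      α α⁺ α⁻ : Fin (2 ℕ.+ r)
      α  = suc (inject₁ i)
      α⁺ = suc (suc i)
      α⁻ = inject₁ (inject₁ i)

      A B : Unit
      A = if does (extended α ℤ.≟ ℤ.suc (extended α⁺))
          then λᵘ α⁺ (extended α⁺) ÷ λᵘ α⁺ (extended α) else 1ᵘ
      B = if does (extended α⁻ ℤ.≟ ℤ.suc (extended α))
          then λᵘ α⁻ (extended α) ÷ λᵘ α⁻ (extended α⁻) else 1ᵘ

  module Matrices where
    open CommutativeRing (HeytingCommutativeRing.commutativeRing heytingCommutativeRing)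
      using (+-monoid)
    open MonoidSum +-monoid using (sum)

    infix  4 _≋_
    infixl 6 _⊕_ _⊖_
    infixl 7 _⊗_
    infixr 8 _•_

    Matrix : ℕ → Set c
    Matrix n = Vector (Vector Carrier n) n

    _≋_ : ∀ {n} → Matrix n → Matrix n → Set ℓ₁
    M ≋ M′ = ∀ i j → M i j ≈ M′ i j

    _⊕_ _⊖_ _⊗_ : ∀ {n} → Matrix n → Matrix n → Matrix n
    (M ⊕ M′) i j = M i j + M′ i j
    (M ⊖ M′) i j = M i j - M′ i j
    (M ⊗ M′) i j = sum (λ k → M i k * M′ k j)

    _•_ : ∀ {n} → Carrier → Matrix n → Matrix n
    (x • M) i j = x * M i j

    I : ∀ {n} → Matrix n
    I i j = if does (i Fin.≟ j) then 1# else 0#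

    E : ∀ {n} → Fin n → Fin n → Matrix n
    E a b i j = if does (i Fin.≟ a) ∧ does (j Fin.≟ b) then 1# else 0#

    product : ∀ {n} → List (Matrix n) → Matrix n
    product = List.foldr _⊗_ I

    StrictlyLowerTriangular UpperTriangular : ∀ {n} → Matrix n → Set ℓ₁
    StrictlyLowerTriangular M = ∀ i j → toℕ i ≤ toℕ j → M i j ≈ 0#
    UpperTriangular M = ∀ i j → toℕ j < toℕ i → M i j ≈ 0#

  module Transfer {r : ℕ} (Q : QSystem K r) (m : MotzkinPath r) (t : Carrier) where
    open CommutativeRing (HeytingCommutativeRing.commutativeRing heytingCommutativeRing)
      using (semiring)
    open SemiringExp semiring using (_^_)
    open Weights Q m public
    open Matrices public

    weight : ∀ {a b} → Edge m a b → Carrier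
    weight (up i)   = 1#
    weight (down i) = t * val (yEven i)
    weight (loop i) = t * val (yOdd i)
    weight {a} {b} (desc _ _ _ _ _ _) =
      t * val (∏ (toℕ b) (toℕ a) yEven ÷ ∏ (suc (toℕ b)) (toℕ a) yOdd)
    weight {a} {b} (asc _ _ _ _ _ _) = (- 1#) ^ (toℕ b ∸ toℕ a ∸ 1)

    transferMatrix : Matrix (suc r)
    transferMatrix b a with edge? m a b
    ... | yes edge = weight edge
    ... | no  _    = 0#

    f e : Fin r → Matrix (suc r)
    f i = I ⊕ E (suc i) (inject₁ i)
    e i = I ⊕ val (yEven i ÷ yOdd (inject₁ i)) • E (inject₁ i) (suc i)

    d : Fin (suc r) → Matrix (suc r)
    d i = I ⊕ (val (yOdd i) - 1#) • E i i

{-# OPTIONS --safe #-}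

-- Reversing the blocks of the disjoint maximal segments turns the
-- sequence (r , … , 1) into (φ r , … , φ 1), where φ reflects every
-- maximal segment and fixes the other indices.  As φ is an involution,
-- k precedes k + 1 in this sequence exactly if φ (k + 1) < φ k, that is,
-- exactly if k and k + 1 lie in a common segment.  The (i , j) entry of a
-- product of the matrices I + c_k E_{k,k+1}, taken in some order of the
-- k, is c_i ⋯ c_{j-1} if i , … , j - 1 occur in this order among the
-- factors, and 0 otherwise.  So the nonzero entries above the diagonal
-- belong to j = i + 1 and to the intervals [i , j - 1] inside a maximal
-- segment, like the edges of the graph.  Applied to τ and c_k =
-- y_{2k} / y_{2k-1}, with row i multiplied by y_{2i-1}, this gives B.
-- Applied to σ and c_k = -1, it gives the transpose of the inverse of
-- f_{i₁} ⋯ f_{iᵣ}, because transposition and inversion both reverse the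
-- order of a product.

module Submission where

open import Defs
open import Algebra.Apartness.Bundles using (HeytingCommutativeRing; HeytingField)
open import Algebra.Bundles using (CommutativeRing; Monoid)
open import Algebra.Definitions using (Invertible)
import Algebra.Properties.CommutativeSemigroup as CommutativeSemigroupProperties
import Algebra.Properties.Monoid as MonoidProperties
import Algebra.Properties.Ring as RingProperties
import Algebra.Properties.Semiring.Exp as SemiringExp
import Algebra.Properties.Semiring.Sum as SemiringSum
open import Data.Fin.Base using (Fin; zero; suc; toℕ; fromℕ<; inject₁)
import Data.Fin.Properties as Fin
open import Data.Integer.Base as ℤ using (ℤ)
import Data.Integer.Properties as ℤ
open import Data.List.Base as List using (List; []; _∷_; _++_; map; allFin; downFrom; upTo; drop; take; reverse; length)
open import Data.List.Membership.Propositional using (_∈_)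
open import Data.List.Membership.Propositional.Properties using (∈-filter⁺; ∈-cartesianProduct⁺; ∈-allFin)
import Data.List.Properties as List
open import Data.List.Relation.Unary.All as All using (All; []; _∷_)
import Data.List.Relation.Unary.All.Properties as All
open import Data.List.Relation.Unary.AllPairs using ([]; _∷_)
open import Data.List.Relation.Unary.Any using (here; there)
open import Data.List.Relation.Unary.Unique.Propositional using (Unique)
import Data.List.Relation.Unary.Unique.Propositional.Properties as Unique
open import Data.Nat.Base using (ℕ; zero; suc; pred; _+_; _∸_; _≤_; _<_; z≤n; s≤s)
import Data.Nat.Properties as ℕ
open import Data.Product.Base using (Σ; ∃; ∃₂; _×_; _,_; proj₁; proj₂)
open import Data.Sum.Base using (_⊎_; inj₁; inj₂)
open import Data.Vec.Functional using (Vector)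
open import Function.Base using (_∘_; id; case_of_)
open import Relation.Binary.PropositionalEquality as ≡ using (_≡_; _≢_; refl; cong; cong₂; sym; trans; subst)
open import Relation.Nullary using (¬_; Dec; yes; no; contradiction)
open import Relation.Nullary.Decidable using (_×-dec_; _⊎-dec_)

-- Block reversals

-- The body of `reverseBlock` with start and size as parameters and entries of any type, so that it
-- can be carried from `Fin r` to natural numbers.
reverseAt : ∀ {A : Set} → ℕ → ℕ → List A → List A
reverseAt s k xs = take s xs ++ reverse (take k (drop s xs)) ++ drop (s + k) xs

-- Reversal moves places and never inspects entries. With `f = toℕ` this passes to natural numbers;
-- with an earlier rearrangement as `f` it pulls that one out of a further reversal.
map-reverseAt : ∀ {A B : Set} (f : A → B) s k xs → map f (reverseAt s k xs) ≡ reverseAt s k (map f xs)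
map-reverseAt f s k xs = begin
  map f (reverseAt s k xs)
    ≡⟨ List.map-++ f (take s xs) _ ⟩
  map f (take s xs) ++ map f (reverse (take k (drop s xs)) ++ drop (s + k) xs)
    ≡⟨ cong₂ _++_ (sym (List.take-map s xs)) (List.map-++ f (reverse (take k (drop s xs))) _) ⟩
  take s (map f xs) ++ map f (reverse (take k (drop s xs))) ++ map f (drop (s + k) xs)
    ≡⟨ cong (take s (map f xs) ++_) (cong₂ _++_
         (trans (List.reverse-map f (take k (drop s xs)))
           (cong reverse (trans (sym (List.take-map k (drop s xs)))
             (cong (take k) (sym (List.drop-map s xs))))))
         (sym (List.drop-map (s + k) xs))) ⟩
  reverseAt s k (map f xs) ∎
  where open ≡.≡-Reasoning

reverseAt-++ : ∀ {A : Set} (xs ys zs : List A) →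
               reverseAt (length xs) (length ys) (xs ++ ys ++ zs) ≡ xs ++ reverse ys ++ zs
reverseAt-++ xs ys zs = cong₂ _++_ (take-++ xs (ys ++ zs)) (cong₂ _++_
  (cong reverse (trans (cong (take (length ys)) (drop-++ xs (ys ++ zs))) (take-++ ys zs)))
  (trans (sym (List.drop-drop (length xs) (length ys) (xs ++ ys ++ zs)))
    (trans (cong (drop (length ys)) (drop-++ xs (ys ++ zs))) (drop-++ ys zs))))
  where
  take-++ : ∀ {A : Set} (xs ys : List A) → take (length xs) (xs ++ ys) ≡ xs
  take-++ []       ys = refl
  take-++ (x ∷ xs) ys = cong (x ∷_) (take-++ xs ys)

  drop-++ : ∀ {A : Set} (xs ys : List A) → drop (length xs) (xs ++ ys) ≡ ys
  drop-++ []       ys = refl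
  drop-++ (x ∷ xs) ys = drop-++ xs ys

downFrom-+ : ∀ m n → downFrom (m + n) ≡ map (_+ n) (downFrom m) ++ downFrom n
downFrom-+ zero    n = refl
downFrom-+ (suc m) n = cong (m + n ∷_) (downFrom-+ m n)

downFrom-< : ∀ n → All (_< n) (downFrom n)
downFrom-< n = All.applyDownFrom⁺₁ id n id

reverse-downFrom-∸ : ∀ n → reverse (downFrom n) ≡ map (λ i → n ∸ suc i) (downFrom n)
reverse-downFrom-∸ n = trans (List.reverse-downFrom n) (go n)
  where
  go : ∀ n → upTo n ≡ map (λ i → n ∸ suc i) (downFrom n)
  go zero    = refl
  go (suc n) = cong₂ _∷_ (sym (ℕ.n∸n≡0 n)) (begin
    List.applyUpTo suc n                          ≡⟨ List.map-upTo suc n ⟨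
    map suc (upTo n)                              ≡⟨ cong (map suc) (go n) ⟩
    map suc (map (λ i → n ∸ suc i) (downFrom n))  ≡⟨ List.map-∘ (downFrom n) ⟨
    map (λ i → suc (n ∸ suc i)) (downFrom n)
      ≡⟨ List.map-cong-local (All.map (λ i<n → sym (ℕ.+-∸-assoc 1 i<n)) (downFrom-< n)) ⟩
    map (n ∸_) (downFrom n) ∎)
    where open ≡.≡-Reasoning

infix 4 _∈[_,_]

_∈[_,_] : ℕ → ℕ → ℕ → Set
x ∈[ α , β ] = α ≤ x × x ≤ β

_∈[_,_]? : ∀ x α β → Dec (x ∈[ α , β ])
x ∈[ α , β ]? = (α ℕ.≤? x) ×-dec (x ℕ.≤? β)

reflect : ℕ → ℕ → ℕ → ℕ
reflect α β x with x ∈[ α , β ]?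
... | yes _ = α + β ∸ x
... | no  _ = x

reflect-inside : ∀ {α β x} → x ∈[ α , β ] → reflect α β x ≡ α + β ∸ x
reflect-inside {α} {β} {x} x∈ with x ∈[ α , β ]?
... | yes _  = refl
... | no  x∉ = contradiction x∈ x∉

reflect-outside : ∀ {α β x} → ¬ x ∈[ α , β ] → reflect α β x ≡ x
reflect-outside {α} {β} {x} x∉ with x ∈[ α , β ]?
... | yes x∈ = contradiction x∈ x∉
... | no  _  = refl

reflect-∈ : ∀ {α β x} → x ∈[ α , β ] → reflect α β x ∈[ α , β ]
reflect-∈ {α} {β} {x} x∈@(α≤x , x≤β) = subst (_∈[ α , β ]) (sym (reflect-inside x∈))
  ( subst (_≤ α + β ∸ x) (ℕ.m+n∸n≡m α β) (ℕ.∸-monoʳ-≤ (α + β) x≤β)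
  , subst (α + β ∸ x ≤_) (ℕ.m+n∸m≡n α β) (ℕ.∸-monoʳ-≤ (α + β) α≤x) )

reflect-involutive : ∀ {α β x} → x ∈[ α , β ] → reflect α β (reflect α β x) ≡ x
reflect-involutive {α} {β} {x} x∈@(α≤x , x≤β) = begin
  reflect α β (reflect α β x) ≡⟨ reflect-inside (reflect-∈ x∈) ⟩
  α + β ∸ reflect α β x       ≡⟨ cong (α + β ∸_) (reflect-inside x∈) ⟩
  α + β ∸ (α + β ∸ x)         ≡⟨ ℕ.m∸[m∸n]≡n (ℕ.≤-trans x≤β (ℕ.m≤n+m β α)) ⟩
  x                           ∎
  where open ≡.≡-Reasoning

-- The length is split into `s` numbers above the block, `suc k` numbers in it and `a` numbers below
-- it. In the decreasing list a block of places is an interval of values, here from `a` to `k + a`,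
-- so reversing the places is reflecting the values.
reverseAt-downFrom : ∀ s k a → let n = s + (suc k + a) in
                     reverseAt s (suc k) (downFrom n) ≡ map (reflect a (k + a)) (downFrom n)
reverseAt-downFrom s k a = begin
  reverseAt s (suc k) (downFrom n)
    ≡⟨ cong (reverseAt s (suc k)) split ⟩
  reverseAt s (suc k) (xs ++ ys ++ zs)
    ≡⟨ cong₂ (λ i j → reverseAt i j (xs ++ ys ++ zs)) (sym (length≡ s)) (sym (length≡ (suc k))) ⟩
  reverseAt (length xs) (length ys) (xs ++ ys ++ zs)
    ≡⟨ reverseAt-++ xs ys zs ⟩
  xs ++ reverse ys ++ zs
    ≡⟨ cong₂ _++_ (sym xs-fixed) (cong₂ _++_ (sym ys-reversed) (sym zs-fixed)) ⟩
  map ρ xs ++ map ρ ys ++ map ρ zs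
    ≡⟨ cong (map ρ xs ++_) (List.map-++ ρ ys zs) ⟨
  map ρ xs ++ map ρ (ys ++ zs)
    ≡⟨ List.map-++ ρ xs (ys ++ zs) ⟨
  map ρ (xs ++ ys ++ zs)
    ≡⟨ cong (map ρ) split ⟨
  map ρ (downFrom n) ∎
  where
  open ≡.≡-Reasoning
  n  = s + (suc k + a)
  ρ  = reflect a (k + a)
  xs = map (_+ (suc k + a)) (downFrom s)
  ys = map (_+ a) (downFrom (suc k))
  zs = downFrom a

  split : downFrom n ≡ xs ++ ys ++ zs
  split = trans (downFrom-+ s _) (cong (xs ++_) (downFrom-+ (suc k) a))

  length≡ : ∀ m {b} → length (map (_+ b) (downFrom m)) ≡ m
  length≡ m = trans (List.length-map _ (downFrom m)) (List.length-downFrom m)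

  xs-fixed : map ρ xs ≡ xs
  xs-fixed = List.map-id-local (All.map⁺ (All.universal
    (λ i → reflect-outside {a} λ (_ , i≤) → ℕ.<⇒≱ (ℕ.m≤n+m (suc k + a) i) i≤) (downFrom s)))

  zs-fixed : map ρ zs ≡ zs
  zs-fixed = List.map-id-local (All.map (λ x<a → reflect-outside λ (a≤x , _) → ℕ.<⇒≱ x<a a≤x) (downFrom-< a))

  ρ-+ : ∀ {i} → i < suc k → ρ (i + a) ≡ (k ∸ i) + a
  ρ-+ {i} (s≤s i≤k) = begin
    ρ (i + a)             ≡⟨ reflect-inside (ℕ.m≤n+m a i , ℕ.+-monoˡ-≤ a i≤k) ⟩
    a + (k + a) ∸ (i + a) ≡⟨ cong₂ _∸_ (ℕ.+-comm a (k + a)) (ℕ.+-comm i a) ⟩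
    k + a + a ∸ (a + i)   ≡⟨ ℕ.∸-+-assoc (k + a + a) a i ⟨
    k + a + a ∸ a ∸ i     ≡⟨ cong (_∸ i) (ℕ.m+n∸n≡m (k + a) a) ⟩
    k + a ∸ i             ≡⟨ ℕ.+-∸-comm a i≤k ⟩
    (k ∸ i) + a           ∎

  ys-reversed : map ρ ys ≡ reverse ys
  ys-reversed = begin
    map ρ (map (_+ a) (downFrom (suc k)))
      ≡⟨ List.map-∘ (downFrom (suc k)) ⟨
    map (λ i → ρ (i + a)) (downFrom (suc k))
      ≡⟨ List.map-cong-local (All.map ρ-+ (downFrom-< (suc k))) ⟩
    map (λ i → (k ∸ i) + a) (downFrom (suc k))
      ≡⟨ List.map-∘ (downFrom (suc k)) ⟩
    map (_+ a) (map (k ∸_) (downFrom (suc k)))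
      ≡⟨ cong (map (_+ a)) (reverse-downFrom-∸ (suc k)) ⟨
    map (_+ a) (reverse (downFrom (suc k)))
      ≡⟨ List.reverse-map (_+ a) (downFrom (suc k)) ⟩
    reverse ys ∎

-- `g` stands for the reversals made already. The new one acts on places, hence on the argument of
-- `g`, and so its reflection is applied first.
toℕ-reverseBlock : ∀ {r} {α β : Fin r} → toℕ α ≤ toℕ β → ∀ {xs} g → map toℕ xs ≡ map g (downFrom r) →
  map toℕ (reverseBlock (α , β) xs) ≡ map (g ∘ reflect (toℕ α) (toℕ β)) (downFrom r)
toℕ-reverseBlock {r} {α} {β} α≤β {xs} g eq = begin
  map toℕ (reverseAt s (suc k) xs)          ≡⟨ map-reverseAt toℕ s (suc k) xs ⟩
  reverseAt s (suc k) (map toℕ xs)          ≡⟨ cong (reverseAt s (suc k)) eq ⟩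
  reverseAt s (suc k) (map g (downFrom r))  ≡⟨ map-reverseAt g s (suc k) (downFrom r) ⟨
  map g (reverseAt s (suc k) (downFrom r))  ≡⟨ cong (map g) reversed ⟩
  map g (map ρ (downFrom r))                ≡⟨ List.map-∘ (downFrom r) ⟨
  map (g ∘ ρ) (downFrom r)                  ∎
  where
  open ≡.≡-Reasoning
  a = toℕ α
  b = toℕ β
  s = r ∸ suc b
  k = b ∸ a
  ρ = reflect a b

  k+a≡b : k + a ≡ b
  k+a≡b = ℕ.m∸n+n≡m α≤β

  r≡ : s + (suc k + a) ≡ r
  r≡ = trans (cong (λ i → s + suc i) k+a≡b) (ℕ.m∸n+n≡m (Fin.toℕ<n β))

  reversed : reverseAt s (suc k) (downFrom r) ≡ map ρ (downFrom r)
  reversed = ≡.subst₂ (λ n i → reverseAt s (suc k) (downFrom n) ≡ map (reflect a i) (downFrom n))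
    r≡ k+a≡b (reverseAt-downFrom s k a)

toℕ-reverse-allFin : ∀ n → map toℕ (reverse (allFin n)) ≡ downFrom n
toℕ-reverse-allFin n = begin
  map toℕ (reverse (allFin n)) ≡⟨ List.reverse-map toℕ (allFin n) ⟩
  reverse (map toℕ (allFin n)) ≡⟨ cong reverse (trans (List.map-tabulate id toℕ) (go n id)) ⟩
  reverse (upTo n)             ≡⟨ List.reverse-upTo n ⟩
  downFrom n                   ∎
  where
  open ≡.≡-Reasoning
  go : ∀ n (f : ℕ → ℕ) → List.tabulate {n = n} (f ∘ toℕ) ≡ List.applyUpTo f n
  go zero    f = refl
  go (suc n) f = cong (f 0 ∷_) (go n (f ∘ suc))

-- Maximal segments

-- What ascending and descending segments have in common, so that one argument serves both halves of
-- the theorem. For `glue` a single common index is enough.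
record SegmentFamily {r : ℕ} (P : Fin r → Fin r → Set) : Set where
  field
    proper   : ∀ {α β} → P α β → toℕ α < toℕ β
    restrict : ∀ {α β α′ β′} → P α β → toℕ α ≤ toℕ α′ → toℕ α′ < toℕ β′ → toℕ β′ ≤ toℕ β → P α′ β′
    glue     : ∀ {α β α′ β′} → P α β → P α′ β′ →
               toℕ α ≤ toℕ α′ → toℕ α′ ≤ toℕ β → toℕ β ≤ toℕ β′ → P α β′

module Rearrangement {r : ℕ} {P : Fin r → Fin r → Set}
                     (P? : ∀ α β → Dec (P α β)) (family : SegmentFamily P) where
  open SegmentFamily family

  infix 4 _∈ˢ_

  _∈ˢ_ : ℕ → Fin r × Fin r → Set
  x ∈ˢ (α , β) = x ∈[ toℕ α , toℕ β ]

  IsMaximal : Fin r × Fin r → Set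
  IsMaximal (α , β) = Maximal P α β

  -- Depending on the order of the end points, either one segment contains the other, or both
  -- contain `x` and `glue` makes their union a segment. Maximality forces equality in each case.
  maximal-unique : ∀ {s s′ x} → IsMaximal s → IsMaximal s′ → x ∈ˢ s → x ∈ˢ s′ → s ≡ s′
  maximal-unique {α , β} {α′ , β′} (p , max) (p′ , max′) (α≤x , x≤β) (α′≤x , x≤β′)
    with ℕ.≤-total (toℕ α) (toℕ α′) | ℕ.≤-total (toℕ β) (toℕ β′)
  ... | inj₁ α≤α′ | inj₁ β≤β′ = cong₂ _,_ (proj₁ (max′ α β′ q α≤α′ ℕ.≤-refl)) (sym (proj₂ (max α β′ q ℕ.≤-refl β≤β′)))
    where q = glue p p′ α≤α′ (ℕ.≤-trans α′≤x x≤β) β≤β′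
  ... | inj₁ α≤α′ | inj₂ β′≤β = cong₂ _,_ (proj₁ (max′ α β p α≤α′ β′≤β)) (proj₂ (max′ α β p α≤α′ β′≤β))
  ... | inj₂ α′≤α | inj₁ β≤β′ = cong₂ _,_ (sym (proj₁ (max α′ β′ p′ α′≤α β≤β′))) (sym (proj₂ (max α′ β′ p′ α′≤α β≤β′)))
  ... | inj₂ α′≤α | inj₂ β′≤β = cong₂ _,_ (sym (proj₁ (max α′ β q α′≤α ℕ.≤-refl))) (proj₂ (max′ α′ β q ℕ.≤-refl β′≤β))
    where q = glue p′ p α′≤α (ℕ.≤-trans α≤x x≤β′) β′≤β

  -- Enlarge the interval as long as possible. The measure `toℕ α + (r ∸ toℕ β)` drops with every
  -- proper enlargement, so the bound `n` is never exhausted.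
  maximal-containing : ∀ {α β} → P α β →
    ∃₂ λ α′ β′ → Maximal P α′ β′ × toℕ α′ ≤ toℕ α × toℕ β ≤ toℕ β′
  maximal-containing {α} {β} p = extend _ α β p (ℕ.n<1+n _)
    where
    extend : ∀ n α β → P α β → toℕ α + (r ∸ toℕ β) < n →
      ∃₂ λ α′ β′ → Maximal P α′ β′ × toℕ α′ ≤ toℕ α × toℕ β ≤ toℕ β′
    extend (suc n) α β p (s≤s size≤n)
      with Fin.any? (λ α′ → Fin.any? (λ β′ → P? α′ β′ ×-dec (toℕ α′ ℕ.≤? toℕ α) ×-dec (toℕ β ℕ.≤? toℕ β′)
             ×-dec ((toℕ α′ ℕ.<? toℕ α) ⊎-dec (toℕ β ℕ.<? toℕ β′))))
    ... | no none = α , β , (p , λ α′ β′ p′ α′≤α β≤β′ →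
            Fin.toℕ-injective (ℕ.≤-antisym α′≤α (ℕ.≮⇒≥ λ α′<α → none (α′ , β′ , p′ , α′≤α , β≤β′ , inj₁ α′<α))) ,
            Fin.toℕ-injective (ℕ.≤-antisym (ℕ.≮⇒≥ λ β<β′ → none (α′ , β′ , p′ , α′≤α , β≤β′ , inj₂ β<β′)) β≤β′))
          , ℕ.≤-refl , ℕ.≤-refl
    ... | yes (α′ , β′ , p′ , α′≤α , β≤β′ , larger)
      with extend n α′ β′ p′ (ℕ.<-≤-trans (smaller larger) size≤n)
      where
      smaller : toℕ α′ < toℕ α ⊎ toℕ β < toℕ β′ → toℕ α′ + (r ∸ toℕ β′) < toℕ α + (r ∸ toℕ β)
      smaller (inj₁ α′<α) = ℕ.+-mono-<-≤ α′<α (ℕ.∸-monoʳ-≤ r β≤β′)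
      smaller (inj₂ β<β′) = ℕ.+-mono-≤-< α′≤α (ℕ.∸-monoʳ-< β<β′ (ℕ.<⇒≤ (Fin.toℕ<n β′)))
    ... | α″ , β″ , max , α″≤α′ , β′≤β″ = α″ , β″ , max , ℕ.≤-trans α″≤α′ α′≤α , ℕ.≤-trans β≤β′ β′≤β″

  -- Prepending a segment composes on the right: the blocks are places
  -- in the sequence, not values.
  reflectAll : List (Fin r × Fin r) → ℕ → ℕ
  reflectAll []            = id
  reflectAll ((α , β) ∷ S) = reflectAll S ∘ reflect (toℕ α) (toℕ β)

  toℕ-reverseBlocks : ∀ {S} → All IsMaximal S →
    map toℕ (List.foldr reverseBlock (reverse (allFin r)) S) ≡ map (reflectAll S) (downFrom r)
  toℕ-reverseBlocks []                      = trans (toℕ-reverse-allFin r) (sym (List.map-id (downFrom r)))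
  toℕ-reverseBlocks {s ∷ S} ((p , _) ∷ max) =
    toℕ-reverseBlock (ℕ.<⇒≤ (proper p)) (reflectAll S) (toℕ-reverseBlocks max)

  reflectAll-outside : ∀ {S x} → All (λ s → ¬ x ∈ˢ s) S → reflectAll S x ≡ x
  reflectAll-outside []                    = refl
  reflectAll-outside {s ∷ S} (x∉s ∷ x∉S) =
    trans (cong (reflectAll S) (reflect-outside x∉s)) (reflectAll-outside x∉S)

  -- A reflection keeps `x` in its own maximal segment, and distinct maximal segments are disjoint,
  -- so all other reflections fix the point, whether they are applied before or after. Uniqueness of
  -- the list excludes a second copy of the same reflection, which would undo the first.
  reflectAll-inside : ∀ {S α β x} → All IsMaximal S → Unique S → (α , β) ∈ S → x ∈ˢ (α , β) →
                      reflectAll S x ≡ reflect (toℕ α) (toℕ β) x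
  reflectAll-inside {S = s ∷ S} (max ∷ maxs) (s∉S ∷ _) (here refl) x∈s =
    reflectAll-outside (All.zipWith
      (λ (max′ , s≢s′) x∈s′ → s≢s′ (maximal-unique max max′ (reflect-∈ x∈s) x∈s′)) (maxs , s∉S))
  reflectAll-inside {S = s ∷ S} (max ∷ maxs) (s∉S ∷ S!) (there s′∈S) x∈s′ =
    trans (cong (reflectAll S) (reflect-outside
            (λ x∈s → All.lookup s∉S s′∈S (maximal-unique max (All.lookup maxs s′∈S) x∈s x∈s′))))
      (reflectAll-inside maxs S! s′∈S x∈s′)

  private
    segments = maximalSegments P?

    pairs = List.cartesianProduct (allFin r) (allFin r)

    segments-maximal : All IsMaximal segments
    segments-maximal = All.all-filter (λ (α , β) → maximal? P? α β) pairs

    segments-unique : Unique segments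
    segments-unique = Unique.filter⁺ _ (Unique.cartesianProduct⁺ (Unique.allFin⁺ r) (Unique.allFin⁺ r))

  φ : ℕ → ℕ
  φ = reflectAll segments

  rearranged : List (Fin r)
  rearranged = List.foldr reverseBlock (reverse (allFin r)) segments

  toℕ-rearranged : map toℕ rearranged ≡ map φ (downFrom r)
  toℕ-rearranged = toℕ-reverseBlocks segments-maximal

  φ-inside : ∀ {α β x} → Maximal P α β → x ∈[ toℕ α , toℕ β ] → φ x ≡ reflect (toℕ α) (toℕ β) x
  φ-inside {α} {β} max = reflectAll-inside segments-maximal segments-unique
    (∈-filter⁺ _ (∈-cartesianProduct⁺ (∈-allFin α) (∈-allFin β)) max)

  data Position (x : ℕ) : Set where
    inside  : ∀ α β → Maximal P α β → x ∈[ toℕ α , toℕ β ] → Position x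
    outside : φ x ≡ x → Position x

  position : ∀ x → Position x
  position x with Fin.any? (λ α → Fin.any? (λ β → maximal? P? α β ×-dec x ∈[ toℕ α , toℕ β ]?))
  ... | yes (α , β , max , x∈) = inside α β max x∈
  ... | no  none               = outside (reflectAll-outside
          (All.map (λ {s} max x∈ → none (proj₁ s , proj₂ s , max , x∈)) segments-maximal))

  φ-involutive : ∀ x → φ (φ x) ≡ x
  φ-involutive x with position x
  ... | outside eq         = trans (cong φ eq) eq
  ... | inside α β max x∈ = begin
    φ (φ x)                                       ≡⟨ cong φ (φ-inside max x∈) ⟩
    φ (reflect (toℕ α) (toℕ β) x)                 ≡⟨ φ-inside max (reflect-∈ x∈) ⟩
    reflect (toℕ α) (toℕ β) (reflect (toℕ α) (toℕ β) x) ≡⟨ reflect-involutive x∈ ⟩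
    x ∎
    where open ≡.≡-Reasoning

  φ-< : ∀ {x} → x < r → φ x < r
  φ-< {x} x<r with position x
  ... | outside eq         = subst (_< r) (sym eq) x<r
  ... | inside α β max x∈ =
    ℕ.≤-<-trans (subst (_≤ toℕ β) (sym (φ-inside max x∈)) (proj₂ (reflect-∈ x∈))) (Fin.toℕ<n β)

  -- Both indices lie in one maximal segment, hence are moved by the same reflection, which reverses
  -- the order.
  φ-descends : ∀ {k l} → toℕ l ≡ suc (toℕ k) → P k l → φ (toℕ l) < φ (toℕ k)
  φ-descends {k} {l} l≡1+k p with maximal-containing p
  ... | α , β , max , α≤k , l≤β = begin-strict
    φ (toℕ l)                 ≡⟨ trans (φ-inside max l∈) (reflect-inside l∈) ⟩
    toℕ α + toℕ β ∸ toℕ l     <⟨ ℕ.∸-monoʳ-< k<l (ℕ.≤-trans l≤β (ℕ.m≤n+m _ (toℕ α))) ⟩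
    toℕ α + toℕ β ∸ toℕ k     ≡⟨ trans (φ-inside max k∈) (reflect-inside k∈) ⟨
    φ (toℕ k)                 ∎
    where
    open ℕ.≤-Reasoning
    k<l = ℕ.≤-reflexive (sym l≡1+k)
    k∈ : toℕ k ∈[ toℕ α , toℕ β ]
    k∈ = α≤k , ℕ.≤-trans (ℕ.<⇒≤ k<l) l≤β
    l∈ : toℕ l ∈[ toℕ α , toℕ β ]
    l∈ = ℕ.≤-trans α≤k (ℕ.<⇒≤ k<l) , l≤β

  -- If `k` lies in a maximal segment, it is the last index there, since otherwise `restrict` would
  -- give `P k l`; so `φ` does not raise `k`. In the same way `l` can only be a first index, and `φ`
  -- does not lower it.
  φ-ascends : ∀ {k l} → toℕ l ≡ suc (toℕ k) → ¬ P k l → φ (toℕ k) < φ (toℕ l)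
  φ-ascends {k} {l} l≡1+k ¬p = ℕ.≤-<-trans φk≤k (ℕ.<-≤-trans k<l l≤φl)
    where
    k<l = ℕ.≤-reflexive (sym l≡1+k)

    φk≤k : φ (toℕ k) ≤ toℕ k
    φk≤k with position (toℕ k)
    ... | outside eq = ℕ.≤-reflexive eq
    ... | inside α β max@(p , _) k∈@(α≤k , k≤β) =
      ℕ.≤-trans (ℕ.≤-reflexive (φ-inside max k∈)) (ℕ.≤-trans (proj₂ (reflect-∈ k∈))
        (ℕ.≮⇒≥ λ k<β → ¬p (restrict p α≤k k<l (subst (_≤ toℕ β) (sym l≡1+k) k<β))))

    l≤φl : toℕ l ≤ φ (toℕ l)
    l≤φl with position (toℕ l)
    ... | outside eq = ℕ.≤-reflexive (sym eq)
    ... | inside α β max@(p , _) l∈@(α≤l , l≤β) =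
      ℕ.≤-trans (ℕ.≤-trans (ℕ.≮⇒≥ λ α<l → ¬p (restrict p (ℕ.≤-pred (subst (toℕ α <_) l≡1+k α<l)) k<l l≤β))
        (proj₁ (reflect-∈ l∈))) (ℕ.≤-reflexive (sym (φ-inside max l∈)))

-- Ascending and descending are the cases `g n = n` and `g n = - n`. Additivity of `g` lets the base
-- point of the linear formula be moved (`shift`), which is the content of both `restrict` and
-- `glue`.
linear-segments : ∀ {r} (h : Vector ℤ r) (g : ℕ → ℤ) → (∀ a b → g (a + b) ≡ g a ℤ.+ g b) →
  SegmentFamily λ α β → toℕ α < toℕ β ×
    (∀ γ → toℕ α ≤ toℕ γ → toℕ γ ≤ toℕ β → h γ ≡ h α ℤ.+ g (toℕ γ ∸ toℕ α))
linear-segments h g g-+ = record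
  { proper   = proj₁
  ; restrict = λ {α} {β} {α′} {β′} (_ , lin) α≤α′ α′<β′ β′≤β → α′<β′ , λ γ α′≤γ γ≤β′ → begin
      h γ                                                       ≡⟨ lin γ (ℕ.≤-trans α≤α′ α′≤γ) (ℕ.≤-trans γ≤β′ β′≤β) ⟩
      h α ℤ.+ g (toℕ γ ∸ toℕ α)                                 ≡⟨ shift α α≤α′ α′≤γ ⟩
      h α ℤ.+ g (toℕ α′ ∸ toℕ α) ℤ.+ g (toℕ γ ∸ toℕ α′)
        ≡⟨ cong (ℤ._+ g (toℕ γ ∸ toℕ α′)) (lin α′ α≤α′ (ℕ.≤-trans (ℕ.<⇒≤ α′<β′) β′≤β)) ⟨
      h α′ ℤ.+ g (toℕ γ ∸ toℕ α′)                               ∎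
  ; glue     = λ {α} {β} {α′} {β′} (α<β , lin) (_ , lin′) α≤α′ α′≤β β≤β′ →
      ℕ.<-≤-trans α<β β≤β′ , λ γ α≤γ γ≤β′ → case ℕ.≤-total (toℕ γ) (toℕ β) of λ where
        (inj₁ γ≤β) → lin γ α≤γ γ≤β
        (inj₂ β≤γ) → let α′≤γ = ℕ.≤-trans α′≤β β≤γ in begin
          h γ                                                   ≡⟨ lin′ γ α′≤γ γ≤β′ ⟩
          h α′ ℤ.+ g (toℕ γ ∸ toℕ α′)                           ≡⟨ cong (ℤ._+ g (toℕ γ ∸ toℕ α′)) (lin α′ α≤α′ α′≤β) ⟩
          h α ℤ.+ g (toℕ α′ ∸ toℕ α) ℤ.+ g (toℕ γ ∸ toℕ α′)     ≡⟨ shift α α≤α′ α′≤γ ⟨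
          h α ℤ.+ g (toℕ γ ∸ toℕ α)                             ∎
  }
  where
  open ≡.≡-Reasoning
  shift : ∀ α {a b c} → a ≤ b → b ≤ c → h α ℤ.+ g (c ∸ a) ≡ h α ℤ.+ g (b ∸ a) ℤ.+ g (c ∸ b)
  shift α {a} {b} {c} a≤b b≤c = begin
    h α ℤ.+ g (c ∸ a)                     ≡⟨ cong (λ d → h α ℤ.+ g (d ∸ a)) (ℕ.m+[n∸m]≡n b≤c) ⟨
    h α ℤ.+ g (b + (c ∸ b) ∸ a)           ≡⟨ cong (λ d → h α ℤ.+ g d) (ℕ.+-∸-comm (c ∸ b) a≤b) ⟩
    h α ℤ.+ g ((b ∸ a) + (c ∸ b))         ≡⟨ cong (λ i → h α ℤ.+ i) (g-+ (b ∸ a) (c ∸ b)) ⟩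
    h α ℤ.+ (g (b ∸ a) ℤ.+ g (c ∸ b))     ≡⟨ ℤ.+-assoc (h α) _ _ ⟨
    h α ℤ.+ g (b ∸ a) ℤ.+ g (c ∸ b)       ∎

module _ {r : ℕ} (m : MotzkinPath r) where
  open MotzkinPath m

  ascending-segments : SegmentFamily (Ascending m)
  ascending-segments = linear-segments height (λ n → ℤ.+ n) ℤ.pos-+

  descending-segments : SegmentFamily (Descending m)
  descending-segments = linear-segments height (λ n → ℤ.- (ℤ.+ n))
    (λ a b → trans (cong ℤ.-_ (ℤ.pos-+ a b)) (ℤ.neg-distrib-+ (ℤ.+ a) (ℤ.+ b)))

-- A chain from i to j is a decreasing run n > φ i > … > φ (j - 1), that
-- is, the sequence of the φ x with x < n, in decreasing order of x, has
-- i , … , j - 1 as a subsequence (φ being an involution).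
data Chain (r : ℕ) (φ : ℕ → ℕ) (j : ℕ) : ℕ → ℕ → Set where
  done : ∀ {n i} → i ≡ j → Chain r φ j n i
  step : ∀ {n i} (k : Fin r) → toℕ k ≡ i → φ i < n → Chain r φ j (φ i) (suc i) → Chain r φ j n i

module _ {r : ℕ} {φ : ℕ → ℕ} where
  chain-≤ : ∀ {j n i} → Chain r φ j n i → i ≤ j
  chain-≤ (done i≡j)      = ℕ.≤-reflexive i≡j
  chain-≤ (step _ _ _ ch) = ℕ.<⇒≤ (chain-≤ ch)

  chain-head : ∀ {j n i} → Chain r φ j n i → i < j → ∃ λ (k : Fin r) → toℕ k ≡ i × φ i < n
  chain-head (done refl)         i<j = contradiction i<j (ℕ.<-irrefl refl)
  chain-head (step k k≡i φi<n _) i<j = k , k≡i , φi<n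

  chain-weaken : ∀ {j n i} → Chain r φ j n i → Chain r φ j (suc n) i
  chain-weaken (done i≡j)           = done i≡j
  chain-weaken (step k k≡i φi<n ch) = step k k≡i (ℕ.m<n⇒m<1+n φi<n) ch

module SegmentChains {r : ℕ} {P : Fin r → Fin r → Set}
                     (P? : ∀ α β → Dec (P α β)) (family : SegmentFamily P) where
  open SegmentFamily family
  open Rearrangement P? family

  -- A single factor is a subsequence in every order. Hence the edges between neighbouring vertices,
  -- present for every path.
  step-chain : ∀ k → Chain r φ (suc (toℕ k)) r (toℕ k)
  step-chain k = step k refl (φ-< (Fin.toℕ<n k)) (done refl)

  -- Successive entries of a chain descend under `φ`, so by `φ-ascends` each neighbouring pair is a
  -- segment. Consecutive pairs share an index and can be glued.
  chain⇒segment : ∀ {α β n i} → Chain r φ (suc (toℕ β)) n i → toℕ α ≡ i → toℕ α < toℕ β → P α β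
  chain⇒segment (done refl) α≡1+β α<β = contradiction (ℕ.≤-reflexive (sym α≡1+β)) (ℕ.<-asym α<β)
  chain⇒segment {α} {β} (step _ _ _ ch) refl α<β = join (chain-head ch (s≤s α<β))
    where
    join : (∃ λ l → toℕ l ≡ suc (toℕ α) × φ (suc (toℕ α)) < φ (toℕ α)) → P α β
    join (l , l≡1+α , φl<φα) with P? α l
    ... | no ¬p = contradiction (subst (λ x → φ x < φ (toℕ α)) (sym l≡1+α) φl<φα) (ℕ.<-asym (φ-ascends l≡1+α ¬p))
    ... | yes p with toℕ l ℕ.≟ toℕ β
    ...   | yes l≡β = subst (P α) (Fin.toℕ-injective l≡β) p
    ...   | no  l≢β = glue p (chain⇒segment ch l≡1+α l<β) (ℕ.<⇒≤ (proper p)) ℕ.≤-refl (ℕ.<⇒≤ l<β)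
      where
      l<β : toℕ l < toℕ β
      l<β = ℕ.≤∧≢⇒< (subst (_≤ toℕ β) (sym l≡1+α) α<β) l≢β

  -- Induction on the length of the segment, each step being a descent by `φ-descends`. The chain
  -- ends at `suc (toℕ β)` because its last factor is `β`.
  segment⇒chain : ∀ {α β} → P α β → Chain r φ (suc (toℕ β)) r (toℕ α)
  segment⇒chain {α} {β} p = go (toℕ β ∸ toℕ α) α refl (inj₂ p) (φ-< (Fin.toℕ<n α))
    where
    -- The alternative `α ≡ β` covers the last index, where no proper segment is left.
    go : ∀ d α → toℕ β ∸ toℕ α ≡ d → α ≡ β ⊎ P α β → ∀ {n} → φ (toℕ α) < n → Chain r φ (suc (toℕ β)) n (toℕ α)
    go d       α d≡ (inj₁ refl) φα<n = step α refl φα<n (done refl)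
    go zero    α d≡ (inj₂ q)    φα<n = contradiction (proper q) (ℕ.≤⇒≯ (ℕ.m∸n≡0⇒m≤n d≡))
    go (suc d) α d≡ (inj₂ q)    φα<n = step α refl φα<n
      (subst (Chain r φ _ _) l≡1+α (go d l d′≡ rest (φ-descends l≡1+α α–l)))
      where
      α<β = proper q
      l = fromℕ< (ℕ.≤-<-trans α<β (Fin.toℕ<n β))

      l≡1+α : toℕ l ≡ suc (toℕ α)
      l≡1+α = Fin.toℕ-fromℕ< _

      l≤β : toℕ l ≤ toℕ β
      l≤β = subst (_≤ toℕ β) (sym l≡1+α) α<β

      α<l = ℕ.≤-reflexive (sym l≡1+α)

      α–l : P α l
      α–l = restrict q ℕ.≤-refl α<l l≤β

      d′≡ : toℕ β ∸ toℕ l ≡ d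
      d′≡ = trans (cong (toℕ β ∸_) l≡1+α) (trans (sym (ℕ.pred[m∸n]≡m∸[1+n] (toℕ β) (toℕ α))) (cong pred d≡))

      rest : l ≡ β ⊎ P l β
      rest with toℕ l ℕ.≟ toℕ β
      ... | yes l≡β = inj₁ (Fin.toℕ-injective l≡β)
      ... | no  l≢β = inj₂ (restrict q (ℕ.<⇒≤ α<l) (ℕ.≤∧≢⇒< l≤β l≢β) ℕ.≤-refl)

-- Matrices

module MatrixProperties {c ℓ₁ ℓ₂} (K : HeytingField c ℓ₁ ℓ₂) where
  open CommutativeRing (HeytingCommutativeRing.commutativeRing (HeytingField.heytingCommutativeRing K))
    renaming (refl to ≈-refl; sym to ≈-sym; trans to ≈-trans; _+_ to _⊹_) hiding (zero)
  open SemiringSum semiring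
  open Matrices K hiding (_⊖_)
  open import Relation.Binary.Reasoning.Setoid setoid

  I-diagonal : ∀ {n} {i j : Fin n} → i ≡ j → I i j ≈ 1#
  I-diagonal {i = i} {j} i≡j with i Fin.≟ j
  ... | yes _   = ≈-refl
  ... | no  i≢j = contradiction i≡j i≢j

  I-off-diagonal : ∀ {n} {i j : Fin n} → i ≢ j → I i j ≈ 0#
  I-off-diagonal {i = i} {j} i≢j with i Fin.≟ j
  ... | yes i≡j = contradiction i≡j i≢j
  ... | no  _   = ≈-refl

  I-symmetric : ∀ {n} (i j : Fin n) → I i j ≈ I j i
  I-symmetric i j with i Fin.≟ j
  ... | yes i≡j = ≈-sym (I-diagonal (sym i≡j))
  ... | no  i≢j = ≈-sym (I-off-diagonal (i≢j ∘ sym))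

  E-row : ∀ {n} (a b j : Fin n) → E a b a j ≈ I b j
  E-row a b j with a Fin.≟ a
  ... | no  a≢a = contradiction refl a≢a
  ... | yes _   = I-symmetric j b

  E-other-row : ∀ {n} {a i : Fin n} (b j : Fin n) → i ≢ a → E a b i j ≈ 0#
  E-other-row {a = a} {i} b j i≢a with i Fin.≟ a
  ... | yes i≡a = contradiction i≡a i≢a
  ... | no  _   = ≈-refl

  E-transpose : ∀ {n} (a b i j : Fin n) → E a b i j ≈ E b a j i
  E-transpose a b i j with i Fin.≟ a | j Fin.≟ b
  ... | yes _ | yes _ = ≈-refl
  ... | yes _ | no _  = ≈-refl
  ... | no _  | yes _ = ≈-refl
  ... | no _  | no _  = ≈-refl

  sum-zero : ∀ {n} {v : Vector Carrier n} → (∀ k → v k ≈ 0#) → sum v ≈ 0#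
  sum-zero {n} v≈0 = ≈-trans (sum-cong-≋ v≈0) (sum-replicate-zero n)

  sum-I : ∀ {n} (i : Fin n) (v : Vector Carrier n) → sum (λ k → I i k * v k) ≈ v i
  sum-I zero v = begin
    1# * v zero ⊹ sum (λ k → 0# * v (suc k)) ≈⟨ +-cong (*-identityˡ _)
                                                  (sum-zero {v = λ k → 0# * v (suc k)} λ k → zeroˡ (v (suc k))) ⟩
    v zero ⊹ 0#                              ≈⟨ +-identityʳ _ ⟩
    v zero                                   ∎
  sum-I (suc i) v = begin
    0# * v zero ⊹ sum (λ k → I i k * v (suc k)) ≈⟨ +-cong (zeroˡ _) (sum-I i (v ∘ suc)) ⟩
    0# ⊹ v (suc i)                              ≈⟨ +-identityˡ _ ⟩
    v (suc i)                                   ∎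

  infix 8 _ᵀ

  _ᵀ : ∀ {n} → Matrix n → Matrix n
  (M ᵀ) i j = M j i

  ⊗-monoid : ℕ → Monoid c ℓ₁
  ⊗-monoid n = record
    { Carrier  = Matrix n
    ; _≈_      = _≋_
    ; _∙_      = _⊗_
    ; ε        = I
    ; isMonoid = record
      { isSemigroup = record
        { isMagma = record
          { isEquivalence = record
            { refl  = λ i j → ≈-refl
            ; sym   = λ eq i j → ≈-sym (eq i j)
            ; trans = λ eq eq′ i j → ≈-trans (eq i j) (eq′ i j)
            }
          ; ∙-cong = λ eq eq′ i j → sum-cong-≋ λ k → *-cong (eq i k) (eq′ k j)
          }
        ; assoc = assoc
        }
      ; identity = (λ M i j → sum-I i (λ k → M k j))
                 , (λ M i j → ≈-trans (sum-cong-≋ λ k →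
                      ≈-trans (*-comm _ _) (*-congʳ (I-symmetric k j))) (sum-I j (M i)))
      }
    }
    where
    assoc : ∀ (A B C : Matrix n) → (A ⊗ B) ⊗ C ≋ A ⊗ (B ⊗ C)
    assoc A B C i j = begin
      sum (λ k → sum (λ l → A i l * B l k) * C k j)
        ≈⟨ sum-cong-≋ (λ k → *-distribʳ-sum (C k j) (λ l → A i l * B l k)) ⟩
      sum (λ k → sum (λ l → A i l * B l k * C k j))
        ≈⟨ ∑-comm (λ k l → A i l * B l k * C k j) ⟩
      sum (λ l → sum (λ k → A i l * B l k * C k j))
        ≈⟨ sum-cong-≋ (λ l → sum-cong-≋ λ k → *-assoc (A i l) (B l k) (C k j)) ⟩
      sum (λ l → sum (λ k → A i l * (B l k * C k j)))
        ≈⟨ sum-cong-≋ (λ l → *-distribˡ-sum (A i l) (λ k → B l k * C k j)) ⟨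
      sum (λ l → A i l * sum (λ k → B l k * C k j)) ∎

  module _ {n : ℕ} where
    open Monoid (⊗-monoid n) public using ()
      renaming (trans to ≋-trans; ∙-cong to ⊗-cong; ∙-congˡ to ⊗-congˡ; identityʳ to ⊗-identityʳ)
    open MonoidProperties (⊗-monoid n) public using () renaming (cancelᶜ to ⊗-cancelᶜ)

  ⊗-transpose : ∀ {n} (A B : Matrix n) → (A ⊗ B) ᵀ ≋ (B ᵀ) ⊗ (A ᵀ)
  ⊗-transpose A B i j = sum-cong-≋ λ k → *-comm (A j k) (B k i)

  -- One form for all factors: `d i` has `a = b`, `e i` lies above the diagonal, `f i` and its
  -- inverse lie below it. Multiplication by it from the left is a row operation.
  elementary : ∀ {n} → Carrier → (a b : Fin n) → Matrix n
  elementary x a b = I ⊕ x • E a b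

  elementary-⊗-other-row : ∀ {n} x {a i : Fin n} (b : Fin n) (M : Matrix n) (j : Fin n) → i ≢ a →
    (elementary x a b ⊗ M) i j ≈ M i j
  elementary-⊗-other-row x {a} {i} b M j i≢a = begin
    sum (λ k → (I i k ⊹ x * E a b i k) * M k j)
      ≈⟨ sum-cong-≋ (λ k → *-congʳ {M k j} (+-congˡ {I i k} (≈-trans (*-congˡ (E-other-row b k i≢a)) (zeroʳ x)))) ⟩
    sum (λ k → (I i k ⊹ 0#) * M k j)
      ≈⟨ sum-cong-≋ (λ k → *-congʳ {M k j} (+-identityʳ (I i k))) ⟩
    sum (λ k → I i k * M k j)
      ≈⟨ sum-I i (λ k → M k j) ⟩
    M i j ∎

  elementary-⊗-row : ∀ {n} x (a b : Fin n) (M : Matrix n) (j : Fin n) →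
    (elementary x a b ⊗ M) a j ≈ M a j ⊹ x * M b j
  elementary-⊗-row x a b M j = begin
    sum (λ k → (I a k ⊹ x * E a b a k) * M k j)
      ≈⟨ sum-cong-≋ (λ k → ≈-trans (distribʳ (M k j) (I a k) _)
           (+-congˡ (≈-trans (*-assoc x _ _) (*-congˡ (*-congʳ (E-row a b k)))))) ⟩
    sum (λ k → I a k * M k j ⊹ x * (I b k * M k j))
      ≈⟨ ∑-distrib-+ (λ k → I a k * M k j) (λ k → x * (I b k * M k j)) ⟩
    sum (λ k → I a k * M k j) ⊹ sum (λ k → x * (I b k * M k j))
      ≈⟨ +-cong (sum-I a (λ k → M k j)) (≈-sym (*-distribˡ-sum x (λ k → I b k * M k j))) ⟩
    M a j ⊹ x * sum (λ k → I b k * M k j)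
      ≈⟨ +-congˡ (*-congˡ (sum-I b (λ k → M k j))) ⟩
    M a j ⊹ x * M b j ∎

  -- For `a ≢ b` the matrix unit squares to zero, so the coefficients add:
  -- `(I + x E)(I + y E) = I + (x + y) E`.
  elementary-inverse : ∀ {n} {x y} {a b : Fin n} → a ≢ b → x ⊹ y ≈ 0# →
                       elementary x a b ⊗ elementary y a b ≋ I
  elementary-inverse {x = x} {y} {a} {b} a≢b x+y≈0 i j = row (i Fin.≟ a)
    where
    row : Dec (i ≡ a) → (elementary x a b ⊗ elementary y a b) i j ≈ I i j
    row (no i≢a) = begin
      (elementary x a b ⊗ elementary y a b) i j ≈⟨ elementary-⊗-other-row x b (elementary y a b) j i≢a ⟩
      I i j ⊹ y * E a b i j                     ≈⟨ +-congˡ (≈-trans (*-congˡ (E-other-row b j i≢a)) (zeroʳ y)) ⟩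
      I i j ⊹ 0#                                ≈⟨ +-identityʳ _ ⟩
      I i j                                     ∎
    row (yes refl) = begin
      (elementary x a b ⊗ elementary y a b) a j
        ≈⟨ elementary-⊗-row x a b (elementary y a b) j ⟩
      (I a j ⊹ y * E a b a j) ⊹ x * (I b j ⊹ y * E a b b j)
        ≈⟨ +-cong (+-congˡ (*-congˡ (E-row a b j)))
             (*-congˡ (≈-trans (+-congˡ (≈-trans (*-congˡ (E-other-row b j (a≢b ∘ sym))) (zeroʳ y))) (+-identityʳ _))) ⟩
      (I a j ⊹ y * I b j) ⊹ x * I b j
        ≈⟨ +-assoc _ _ _ ⟩
      I a j ⊹ (y * I b j ⊹ x * I b j)
        ≈⟨ +-congˡ (≈-trans (+-comm _ _) (≈-sym (distribʳ (I b j) x y))) ⟩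
      I a j ⊹ (x ⊹ y) * I b j
        ≈⟨ +-congˡ (≈-trans (*-congʳ x+y≈0) (zeroˡ _)) ⟩
      I a j ⊹ 0#
        ≈⟨ +-identityʳ _ ⟩
      I a j ∎

  -- Transposition turns the order of the factors around, so the
  -- transposes of the inverse factors are multiplied in the same order.
  product-inverse : ∀ {n} {X : Set} (A B : X → Matrix n) →
    (∀ x → A x ⊗ B x ᵀ ≋ I) → (∀ x → B x ᵀ ⊗ A x ≋ I) → ∀ xs →
    product (map A xs) ⊗ product (map B xs) ᵀ ≋ I ×
    product (map B xs) ᵀ ⊗ product (map A xs) ≋ I
  product-inverse A B AB≋I BA≋I []       = ≋-trans (⊗-congˡ Iᵀ≋I) (⊗-identityʳ I) , ≋-trans (⊗-identityʳ (I ᵀ)) Iᵀ≋I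
    where
    Iᵀ≋I : I ᵀ ≋ I
    Iᵀ≋I i j = I-symmetric j i
  product-inverse A B AB≋I BA≋I (x ∷ xs) with product-inverse A B AB≋I BA≋I xs
  ... | rightInverse , leftInverse =
    ≋-trans (⊗-congˡ {x = A x ⊗ PA} (⊗-transpose (B x) PB))
      (≋-trans (⊗-cancelᶜ rightInverse (A x) (B x ᵀ)) (AB≋I x)) ,
    ≋-trans (⊗-cong (⊗-transpose (B x) PB) (λ i j → ≈-refl {(A x ⊗ PA) i j}))
      (≋-trans (⊗-cancelᶜ (BA≋I x) (PB ᵀ) PA) leftInverse)
    where
    PA = product (map A xs)
    PB = product (map B xs)

-- Products of weights over intervals of indices

filter-cong-local : ∀ {A : Set} {P Q : A → Set} (P? : ∀ x → Dec (P x)) (Q? : ∀ x → Dec (Q x)) {xs} →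
  All (λ x → (P x → Q x) × (Q x → P x)) xs → List.filter P? xs ≡ List.filter Q? xs
filter-cong-local P? Q? []                              = refl
filter-cong-local P? Q? {x ∷ xs} ((P⇒Q , Q⇒P) ∷ P⇔Q) with P? x
... | yes p = trans (cong (x ∷_) (filter-cong-local P? Q? P⇔Q)) (sym (List.filter-accept Q? (P⇒Q p)))
... | no ¬p = trans (filter-cong-local P? Q? P⇔Q) (sym (List.filter-reject Q? (¬p ∘ Q⇒P)))

allFin-split : ∀ {n} (k : Fin n) → ∃₂ λ xs ys → allFin n ≡ xs ++ k ∷ ys ×
               All (λ i → toℕ i < toℕ k) xs × All (λ i → toℕ k < toℕ i) ys
allFin-split zero = [] , _ , refl , [] , All.tabulate⁺ λ i → s≤s z≤n
allFin-split {suc n} (suc k) with allFin-split k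
... | xs , ys , eq , xs<k , k<ys =
  zero ∷ map suc xs , map suc ys ,
  cong (zero ∷_) (trans (sym (List.map-tabulate id suc)) (trans (cong (map suc) eq) (List.map-++ suc xs (k ∷ ys)))) ,
  s≤s z≤n ∷ All.map⁺ (All.map s≤s xs<k) , All.map⁺ (All.map s≤s k<ys)

module Intervals {c ℓ₁ ℓ₂} (K : HeytingField c ℓ₁ ℓ₂) {n : ℕ} (u : Vector (Unit K) n) where

  private
    between? : ∀ lo hi (i : Fin n) → Dec (lo ≤ toℕ i × toℕ i < hi)
    between? lo hi i = (lo ℕ.≤? toℕ i) ×-dec (toℕ i ℕ.<? hi)

    interval : ℕ → ℕ → List (Fin n)
    interval lo hi = List.filter (between? lo hi) (allFin n)

  ∏-empty : ∀ lo → ∏ K lo lo u ≡ 1ᵘ K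
  ∏-empty lo = cong (List.foldr (_·_ K) (1ᵘ K) ∘ map u)
    (List.filter-none (between? lo lo) (All.universal (λ i (lo≤i , i<lo) → ℕ.<⇒≱ i<lo lo≤i) (allFin n)))

  -- Filtering keeps the order of `allFin`: nothing before `k` passes either filter, `k` passes only
  -- the first, and after `k` the bounds `lo` and `suc lo` select the same indices. The lists agree,
  -- so the products are propositionally equal.
  ∏-step : ∀ {lo hi} (k : Fin n) → toℕ k ≡ lo → lo < hi → ∏ K lo hi u ≡ _·_ K (u k) (∏ K (suc lo) hi u)
  ∏-step {lo} {hi} k refl k<hi = cong (List.foldr (_·_ K) (1ᵘ K) ∘ map u) (split (allFin-split k))
    where
    open ≡.≡-Reasoning
    split : (∃₂ λ xs ys → allFin n ≡ xs ++ k ∷ ys ×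
               All (λ i → toℕ i < toℕ k) xs × All (λ i → toℕ k < toℕ i) ys) →
            interval lo hi ≡ k ∷ interval (suc lo) hi
    split (xs , ys , eq , xs<k , k<ys) = begin
      interval lo hi
        ≡⟨ trans (cong (List.filter P?) eq) (List.filter-++ P? xs (k ∷ ys)) ⟩
      List.filter P? xs ++ List.filter P? (k ∷ ys)
        ≡⟨ cong₂ _++_ (List.filter-none P? (All.map (λ i<k (k≤i , _) → ℕ.<⇒≱ i<k k≤i) xs<k))
             (List.filter-accept P? (ℕ.≤-refl , k<hi)) ⟩
      k ∷ List.filter P? ys
        ≡⟨ cong (k ∷_) (filter-cong-local P? Q? (All.map (λ k<i →
             (λ (_ , i<hi) → k<i , i<hi) , (λ (_ , i<hi) → ℕ.<⇒≤ k<i , i<hi)) k<ys)) ⟩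
      k ∷ List.filter Q? ys
        ≡⟨ cong (k ∷_) (cong₂ _++_ (List.filter-none Q? (All.map (λ i<k (k<i , _) → ℕ.<-asym i<k k<i) xs<k))
             (List.filter-reject Q? (λ (k<k , _) → ℕ.<-irrefl refl k<k))) ⟨
      k ∷ (List.filter Q? xs ++ List.filter Q? (k ∷ ys))
        ≡⟨ cong (k ∷_) (trans (cong (List.filter Q?) eq) (List.filter-++ Q? xs (k ∷ ys))) ⟨
      k ∷ interval (suc lo) hi ∎
      where
      P? = between? lo hi
      Q? = between? (suc lo) hi

-- Products of elementary matrices

module Products {c ℓ₁ ℓ₂} (K : HeytingField c ℓ₁ ℓ₂) where
  open CommutativeRing (HeytingCommutativeRing.commutativeRing (HeytingField.heytingCommutativeRing K))
    renaming (refl to ≈-refl; sym to ≈-sym; trans to ≈-trans; reflexive to ≈-reflexive; _+_ to _⊹_) hiding (zero)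
  open CommutativeSemigroupProperties *-commutativeSemigroup using (interchange)
  open SemiringExp semiring using (_^_)
  open Matrices K hiding (_⊖_)
  open MatrixProperties K
  open import Relation.Binary.Reasoning.Setoid setoid

  module _ {n : ℕ} (y : Vector Carrier n) where

    scaling : Fin n → Matrix n
    scaling k = elementary (y k - 1#) k k

    scaling-⊗ : ∀ k M j → (scaling k ⊗ M) k j ≈ y k * M k j
    scaling-⊗ k M j = begin
      (scaling k ⊗ M) k j                ≈⟨ elementary-⊗-row (y k - 1#) k k M j ⟩
      M k j ⊹ (y k - 1#) * M k j         ≈⟨ +-congʳ (*-identityˡ _) ⟨
      1# * M k j ⊹ (y k - 1#) * M k j    ≈⟨ distribʳ _ _ _ ⟨
      (1# ⊹ (y k - 1#)) * M k j          ≈⟨ *-congʳ (≈-trans (+-comm _ _) (+-assoc _ _ _)) ⟩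
      (y k ⊹ (- 1# ⊹ 1#)) * M k j        ≈⟨ *-congʳ (≈-trans (+-congˡ (-‿inverseˡ 1#)) (+-identityʳ _)) ⟩
      y k * M k j                        ∎

    product-scaling-∉ : ∀ {xs i} → All (i ≢_) xs → ∀ j → product (map scaling xs) i j ≈ I i j
    product-scaling-∉ {[]}     []               j = ≈-refl
    product-scaling-∉ {k ∷ xs} (i≢k ∷ i∉xs) j = ≈-trans
      (elementary-⊗-other-row _ k (product (map scaling xs)) j i≢k) (product-scaling-∉ i∉xs j)

    -- The factor for `k` touches row `k` alone, so a row is scaled once for each occurrence of its
    -- index, which is once in a list without repetition.
    product-scaling-∈ : ∀ {xs i} → Unique xs → i ∈ xs → ∀ j → product (map scaling xs) i j ≈ y i * I i j
    product-scaling-∈ {k ∷ xs} (k∉xs ∷ _)   (here refl)  j =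
      ≈-trans (scaling-⊗ k (product (map scaling xs)) j) (*-congˡ (product-scaling-∉ k∉xs j))
    product-scaling-∈ {k ∷ xs} (k∉xs ∷ xs!) (there i∈xs) j = ≈-trans
      (elementary-⊗-other-row _ k (product (map scaling xs)) j (All.lookup k∉xs i∈xs ∘ sym))
      (product-scaling-∈ xs! i∈xs j)

    product-scaling-allFin : ∀ M i j → (product (map scaling (allFin n)) ⊗ M) i j ≈ y i * M i j
    product-scaling-allFin M i j = begin
      sum (λ k → product (map scaling (allFin n)) i k * M k j)
        ≈⟨ sum-cong-≋ (λ k → ≈-trans (*-congʳ {M k j} (product-scaling-∈ (Unique.allFin⁺ n) (∈-allFin i) k))
             (*-assoc (y i) _ _)) ⟩
      sum (λ k → y i * (I i k * M k j))   ≈⟨ *-distribˡ-sum (y i) (λ k → I i k * M k j) ⟨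
      y i * sum (λ k → I i k * M k j)     ≈⟨ *-congˡ (sum-I i (λ k → M k j)) ⟩
      y i * M i j                         ∎
      where open SemiringSum semiring

  value : ∀ {r φ} → Vector Carrier r → ∀ {j n i} → Chain r φ j n i → Carrier
  value c (done _)        = 1#
  value c (step k _ _ ch) = c k * value c ch

  module Bidiagonal {r : ℕ} (φ : ℕ → ℕ) (φ-involutive : ∀ x → φ (φ x) ≡ x) (c : Vector Carrier r) where

    factor : Fin r → Matrix (suc r)
    factor k = elementary (c k) (inject₁ k) (suc k)

    -- Induction on the number of factors. Putting the factor `k` in front adds `c k` times row
    -- `k + 1` to row `k`, just as a chain is prolonged by a first step at `k`. The equations on
    -- `x`, `y` and `m` leave the indices of the chain free, so that a chain found at other, equal
    -- indices can be supplied.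
    chain-entry : ∀ {n xs} → map toℕ xs ≡ map φ (downFrom n) → ∀ i j {x y m} (ch : Chain r φ y m x) →
      toℕ i ≡ x → toℕ j ≡ y → m ≡ n → product (map factor xs) i j ≈ value c ch
    no-chain-entry : ∀ {n xs} → map toℕ xs ≡ map φ (downFrom n) → ∀ i j →
      ¬ Chain r φ (toℕ j) n (toℕ i) → product (map factor xs) i j ≈ 0#

    chain-entry {zero}  {[]}     eq i j (done x≡y)        refl refl refl = I-diagonal (Fin.toℕ-injective x≡y)
    chain-entry {suc n} {k ∷ xs} eq i j {x} ch refl refl refl with List.∷-injective eq
    ... | k≡φn , eq′ = row ch (i Fin.≟ inject₁ k)
      where
      M = product (map factor xs)

      -- Involutivity turns the value `k = φ n` of the first factor into its place `n`.
      φi≡n : i ≡ inject₁ k → φ (toℕ i) ≡ n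
      φi≡n refl = trans (cong φ (trans (Fin.toℕ-inject₁ k) k≡φn)) (φ-involutive n)

      row : (ch : Chain r φ (toℕ j) (suc n) (toℕ i)) → Dec (i ≡ inject₁ k) → (factor k ⊗ M) i j ≈ value c ch
      row (done i≡j) (no i≢k) = ≈-trans (elementary-⊗-other-row (c k) (suc k) M j i≢k)
        (chain-entry eq′ i j (done i≡j) refl refl refl)
      -- The chain does not start with the first factor, as `φ i = n` would give `i = φ n = k`. So
      -- it lies in the rest of the product.
      row (step l l≡i φi≤n ch) (no i≢k) = ≈-trans (elementary-⊗-other-row (c k) (suc k) M j i≢k)
        (chain-entry eq′ i j (step l l≡i φi<n ch) refl refl refl)
        where
        φi<n : φ (toℕ i) < n
        φi<n = ℕ.≤∧≢⇒< (ℕ.≤-pred φi≤n) λ φi≡n → i≢k (Fin.toℕ-injective (trans (sym (φ-involutive (toℕ i)))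
          (trans (cong φ φi≡n) (trans (sym k≡φn) (sym (Fin.toℕ-inject₁ k))))))
      -- Here `j = k`, and the added row contributes an entry below the diagonal, to which no chain
      -- leads.
      row (done i≡j) (yes refl) = begin
        (factor k ⊗ M) i j           ≈⟨ elementary-⊗-row (c k) i (suc k) M j ⟩
        M i j ⊹ c k * M (suc k) j
          ≈⟨ +-cong (chain-entry eq′ i j (done i≡j) refl refl refl)
               (*-congˡ (no-chain-entry eq′ (suc k) j λ ch → ℕ.<⇒≱ (chain-≤ ch)
                 (ℕ.≤-reflexive (trans (sym i≡j) (Fin.toℕ-inject₁ k))))) ⟩
        1# ⊹ c k * 0#                ≈⟨ ≈-trans (+-congˡ (zeroʳ _)) (+-identityʳ _) ⟩
        1#                           ∎
      -- Without the first factor there is no chain from `i` to `j`, so the entry comes from the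
      -- added row alone.
      row (step l l≡i φi≤n ch) (yes refl) = begin
        (factor k ⊗ M) i j           ≈⟨ elementary-⊗-row (c k) i (suc k) M j ⟩
        M i j ⊹ c k * M (suc k) j
          ≈⟨ +-cong (no-chain-entry eq′ i j no-chain)
               (*-cong (≈-reflexive (cong c (Fin.toℕ-injective (trans (sym (Fin.toℕ-inject₁ k)) (sym l≡i)))))
                 (chain-entry eq′ (suc k) j ch (cong suc (sym (Fin.toℕ-inject₁ k))) refl (φi≡n refl))) ⟩
        0# ⊹ c l * value c ch          ≈⟨ +-identityˡ _ ⟩
        c l * value c ch               ∎
        where
        no-chain : ¬ Chain r φ (toℕ j) n (toℕ i)
        no-chain (done i≡j)        = ℕ.<⇒≢ (chain-≤ ch) i≡j
        no-chain (step _ _ φi<n _) = ℕ.<⇒≢ φi<n (φi≡n refl)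

    no-chain-entry {zero}  {[]}     eq i j ¬ch = I-off-diagonal λ i≡j → ¬ch (done (cong toℕ i≡j))
    no-chain-entry {suc n} {k ∷ xs} eq i j ¬ch with List.∷-injective eq
    ... | k≡φn , eq′ = row (i Fin.≟ inject₁ k)
      where
      M = product (map factor xs)

      row : Dec (i ≡ inject₁ k) → (factor k ⊗ M) i j ≈ 0#
      row (no i≢k) = ≈-trans (elementary-⊗-other-row (c k) (suc k) M j i≢k)
        (no-chain-entry eq′ i j (¬ch ∘ chain-weaken))
      row (yes refl) = begin
        (factor k ⊗ M) i j           ≈⟨ elementary-⊗-row (c k) i (suc k) M j ⟩
        M i j ⊹ c k * M (suc k) j
          ≈⟨ +-cong (no-chain-entry eq′ i j (¬ch ∘ chain-weaken)) (*-congˡ (no-chain-entry eq′ (suc k) j no-chain)) ⟩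
        0# ⊹ c k * 0#                ≈⟨ ≈-trans (+-congˡ (zeroʳ _)) (+-identityʳ _) ⟩
        0#                           ∎
        where
        φi≡n : φ (toℕ i) ≡ n
        φi≡n = trans (cong φ (trans (Fin.toℕ-inject₁ k) k≡φn)) (φ-involutive n)

        no-chain : ¬ Chain r φ (toℕ j) n (suc (toℕ k))
        no-chain ch = ¬ch (step k (sym (Fin.toℕ-inject₁ k)) (ℕ.≤-reflexive (cong suc φi≡n))
          (≡.subst₂ (Chain r φ (toℕ j)) (sym φi≡n) (cong suc (sym (Fin.toℕ-inject₁ k))) ch))

  value-∏ : ∀ {r φ} (u : Vector (Unit K) r) (w : Vector (Unit K) (suc r)) →
    ∀ {j n i} (ch : Chain r φ j n i) →
    value (λ k → Unit.val (_÷_ K (u k) (w (inject₁ k)))) ch ≈ Unit.val (∏ K i j u) * Unit.inv (∏ K i j w)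
  value-∏ u w {j} (done refl) = ≈-sym (≈-trans
    (*-cong (≈-reflexive (cong Unit.val (Intervals.∏-empty K u j))) (≈-reflexive (cong Unit.inv (Intervals.∏-empty K w j))))
    (*-identityˡ 1#))
  value-∏ u w {j} {i = i} (step k k≡i _ ch) = begin
    (Unit.val (u k) * Unit.inv (w (inject₁ k))) * value _ ch
      ≈⟨ *-congˡ (value-∏ u w ch) ⟩
    (Unit.val (u k) * Unit.inv (w (inject₁ k))) * (Unit.val (∏ K (suc i) j u) * Unit.inv (∏ K (suc i) j w))
      ≈⟨ interchange _ _ _ _ ⟩
    (Unit.val (u k) * Unit.val (∏ K (suc i) j u)) * (Unit.inv (w (inject₁ k)) * Unit.inv (∏ K (suc i) j w))
      ≈⟨ *-cong (≈-reflexive (cong Unit.val (Intervals.∏-step K u k k≡i (chain-≤ ch))))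
           (≈-reflexive (cong Unit.inv (Intervals.∏-step K w (inject₁ k) (trans (Fin.toℕ-inject₁ k) k≡i) (chain-≤ ch)))) ⟨
    Unit.val (∏ K i j u) * Unit.inv (∏ K i j w) ∎

  value-sign : ∀ {r φ} {j n i} (ch : Chain r φ j n i) →
    value (λ _ → - 1#) ch ≈ (- 1#) ^ (j ∸ i)
  value-sign {j = j} (done refl) = ≈-reflexive (cong ((- 1#) ^_) (sym (ℕ.n∸n≡0 j)))
  value-sign {j = j} {i = i} (step k _ _ ch) = ≈-trans (*-congˡ (value-sign ch))
    (≈-reflexive (cong ((- 1#) ^_) (sym (ℕ.+-∸-assoc 1 (chain-≤ ch)))))

-- The transfer matrix

module LongEdges {r : ℕ} {P : Fin r → Fin r → Set}
                 (P? : ∀ α β → Dec (P α β)) (family : SegmentFamily P) where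
  open SegmentFamily family
  open Rearrangement P? family
  open SegmentChains P? family

  -- Vertices `low < high` of the graph correspond to the interval of path indices from `low` to
  -- `high - 1`. This is why an edge may reach the vertex `suc (toℕ β)`, one beyond the segment; the
  -- distance of at least 2 makes the interval proper.
  long⇒chain : ∀ {α β} {low high : Fin (suc r)} → Maximal P α β → toℕ α ≤ toℕ low →
    2 + toℕ low ≤ toℕ high → toℕ high ≤ suc (toℕ β) → Chain r φ (toℕ high) r (toℕ low)
  long⇒chain {low = low} {suc l} (p , _) α≤low (s≤s low<l) (s≤s l≤β) =
    subst (Chain r φ _ r) k≡low (segment⇒chain
      (restrict p (subst (_ ≤_) (sym k≡low) α≤low) (subst (_< toℕ l) (sym k≡low) low<l) l≤β))
    where
    k≡low : toℕ (fromℕ< (ℕ.<-trans low<l (Fin.toℕ<n l))) ≡ toℕ low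
    k≡low = Fin.toℕ-fromℕ< _

  -- An edge with direction and weight forgotten, to be read downwards for descending segments and
  -- upwards for ascending ones.
  data Link (low high : Fin (suc r)) : Set where
    equal    : low ≡ high → Link low high
    adjacent : ∀ k → inject₁ k ≡ low → suc k ≡ high → Link low high
    distant  : ∀ α β → Maximal P α β → toℕ α ≤ toℕ low →
               2 + toℕ low ≤ toℕ high → toℕ high ≤ suc (toℕ β) → Link low high

  chain⇒link : ∀ low high {n} → Chain r φ (toℕ high) n (toℕ low) → Link low high
  chain⇒link low high (done low≡high) = equal (Fin.toℕ-injective low≡high)
  chain⇒link low zero    (step _ _ _ ch) = contradiction (chain-≤ ch) λ ()
  chain⇒link low (suc l) ch@(step k k≡low _ ch′) with toℕ low ℕ.≟ toℕ l
  ... | yes low≡l = adjacent k (Fin.toℕ-injective (trans (Fin.toℕ-inject₁ k) k≡low))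
          (cong suc (Fin.toℕ-injective (trans k≡low low≡l)))
  ... | no  low≢l with maximal-containing (chain⇒segment ch k≡low (subst (_< toℕ l) (sym k≡low) low<l))
    where low<l = ℕ.≤∧≢⇒< (ℕ.≤-pred (chain-≤ ch′)) low≢l
  ...   | α , β , max , α≤k , l≤β = distant α β max (subst (_ ≤_) k≡low α≤k)
            (s≤s (ℕ.≤∧≢⇒< (ℕ.≤-pred (chain-≤ ch′)) low≢l)) (s≤s l≤β)

module Entries {c ℓ₁ ℓ₂} (K : HeytingField c ℓ₁ ℓ₂) {r : ℕ}
               (Q : QSystem K r) (m : MotzkinPath r) (t : HeytingField.Carrier K) where
  open CommutativeRing (HeytingCommutativeRing.commutativeRing (HeytingField.heytingCommutativeRing K))
    renaming (refl to ≈-refl; sym to ≈-sym; trans to ≈-trans; reflexive to ≈-reflexive; _+_ to _⊹_) hiding (zero)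
  open CommutativeSemigroupProperties *-commutativeSemigroup using (x∙yz≈y∙xz)
  open RingProperties ring using (-1*x≈-x; -‿involutive; -0#≈0#)
  open SemiringExp semiring using (_^_)
  open Transfer K Q m t
  open MatrixProperties K
  open Products K
  open Unit
  open import Relation.Binary.Reasoning.Setoid setoid

  -- `edge?` returns some edge if there is one. Asking for the weight of every edge from `j` to `i`
  -- makes the entry independent of the constructor and the segment that it finds.
  transfer-entry : ∀ i j {x} → (∀ (edge : Edge m j i) → weight edge ≈ x) → (¬ Edge m j i → 0# ≈ x) →
                   transferMatrix i j ≈ x
  transfer-entry i j edge⇒ no-edge⇒ with edge? m j i
  ... | yes edge    = edge⇒ edge
  ... | no  no-edge = no-edge⇒ no-edge

  -- Entries on and above the diagonal

  private
    ratio : Vector Carrier r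
    ratio k = val (_÷_ K (yEven k) (yOdd (inject₁ k)))

    eProduct : Matrix (suc r)
    eProduct = product (map e (τ m))

    module ↘ = Rearrangement (descending? m) (descending-segments m)
    module ↘-Chains = SegmentChains (descending? m) (descending-segments m)
    module ↘-Edges = LongEdges (descending? m) (descending-segments m)
    module ↘-Product = Bidiagonal ↘.φ ↘.φ-involutive ratio

    eProduct-chain : ∀ i j (ch : Chain r ↘.φ (toℕ j) r (toℕ i)) → eProduct i j ≈ value ratio ch
    eProduct-chain i j ch = ↘-Product.chain-entry ↘.toℕ-rearranged i j ch refl refl refl

    eProduct-no-chain : ∀ i j → ¬ Chain r ↘.φ (toℕ j) r (toℕ i) → eProduct i j ≈ 0#
    eProduct-no-chain = ↘-Product.no-chain-entry ↘.toℕ-rearranged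

    -- Scaling row `i` cancels the first odd weight in the denominator. What remains starts at
    -- `suc (toℕ i)`, as in the weight of a `desc` edge.
    yOdd-eProduct : ∀ i j (ch : Chain r ↘.φ (toℕ j) r (toℕ i)) → toℕ i < toℕ j →
      val (yOdd i) * eProduct i j ≈ val (_÷_ K (∏ K (toℕ i) (toℕ j) yEven) (∏ K (suc (toℕ i)) (toℕ j) yOdd))
    yOdd-eProduct i j ch i<j = begin
      val (yOdd i) * eProduct i j
        ≈⟨ *-congˡ (≈-trans (eProduct-chain i j ch) (value-∏ yEven yOdd ch)) ⟩
      val (yOdd i) * (val evens * inv (∏ K (toℕ i) (toℕ j) yOdd))
        ≈⟨ *-congˡ (*-congˡ (≈-reflexive (cong inv (Intervals.∏-step K yOdd i refl i<j)))) ⟩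
      val (yOdd i) * (val evens * (inv (yOdd i) * inv odds))
        ≈⟨ x∙yz≈y∙xz _ _ _ ⟩
      val evens * (val (yOdd i) * (inv (yOdd i) * inv odds))
        ≈⟨ *-congˡ (≈-trans (≈-sym (*-assoc _ _ _)) (≈-trans (*-congʳ (inverse (yOdd i))) (*-identityˡ _))) ⟩
      val evens * inv odds ∎
      where
      evens = ∏ K (toℕ i) (toℕ j) yEven
      odds  = ∏ K (suc (toℕ i)) (toℕ j) yOdd

    -- The weight of `down` is given without interval products, so this case is computed apart; the
    -- odd weight cancels entirely.
    yOdd-eProduct-adjacent : ∀ k → val (yOdd (inject₁ k)) * eProduct (inject₁ k) (suc k) ≈ val (yEven k)
    yOdd-eProduct-adjacent k = begin
      val y * eProduct (inject₁ k) (suc k)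
        ≈⟨ *-congˡ (≈-trans (↘-Product.chain-entry ↘.toℕ-rearranged (inject₁ k) (suc k)
             (↘-Chains.step-chain k) (Fin.toℕ-inject₁ k) refl refl) (*-identityʳ _)) ⟩
      val y * (val (yEven k) * inv y) ≈⟨ x∙yz≈y∙xz _ _ _ ⟩
      val (yEven k) * (val y * inv y) ≈⟨ *-congˡ (inverse y) ⟩
      val (yEven k) * 1#              ≈⟨ *-identityʳ _ ⟩
      val (yEven k)                   ∎
      where y = yOdd (inject₁ k)

    chain⇒down-edge : ∀ {i j} → Chain r ↘.φ (toℕ j) r (toℕ i) → Edge m j i
    chain⇒down-edge {i} {j} ch with ↘-Edges.chain⇒link i j ch
    ... | ↘-Edges.equal refl               = loop i
    ... | ↘-Edges.adjacent k refl refl     = down k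
    ... | ↘-Edges.distant α β max p q s    = desc α β max p q s

  -- Chains of no, one and several steps correspond to `loop`, `down` and `desc` edges. The edges
  -- `up` and `asc` belong to entries below the diagonal.
  upper-entry : ∀ i j → toℕ i ≤ toℕ j → transferMatrix i j ≈ t * (val (yOdd i) * eProduct i j)
  upper-entry i j i≤j = transfer-entry i j (edge-weight i≤j)
    λ no-edge → ≈-sym (≈-trans (*-congˡ (≈-trans
      (*-congˡ (eProduct-no-chain i j (no-edge ∘ chain⇒down-edge))) (zeroʳ _))) (zeroʳ t))
    where
    edge-weight : ∀ {i j} → toℕ i ≤ toℕ j → (edge : Edge m j i) → weight edge ≈ t * (val (yOdd i) * eProduct i j)
    edge-weight i≤j (up k)   = contradiction (ℕ.≤-reflexive (cong suc (Fin.toℕ-inject₁ k))) (ℕ.≤⇒≯ i≤j)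
    edge-weight i≤j (down k) = *-congˡ (≈-sym (yOdd-eProduct-adjacent k))
    edge-weight i≤j (loop i) = *-congˡ (≈-sym (≈-trans (*-congˡ (eProduct-chain i i (done refl))) (*-identityʳ _)))
    edge-weight {i} {j} i≤j (desc α β max p q s) =
      *-congˡ (≈-sym (yOdd-eProduct i j (↘-Edges.long⇒chain max p q s) (ℕ.<⇒≤ q)))
    edge-weight i≤j (asc _ _ _ _ q _) = contradiction i≤j (ℕ.<⇒≱ (ℕ.<⇒≤ q))

  lower-eProduct : ∀ i j → toℕ j < toℕ i → eProduct i j ≈ 0#
  lower-eProduct i j j<i = eProduct-no-chain i j λ ch → ℕ.<⇒≱ j<i (chain-≤ ch)

  -- Entries below the diagonal and the inverse of the product of the `f i`

  private
    module ↗ = Rearrangement (ascending? m) (ascending-segments m)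
    module ↗-Chains = SegmentChains (ascending? m) (ascending-segments m)
    module ↗-Edges = LongEdges (ascending? m) (ascending-segments m)
    module ↗-Product = Bidiagonal {r} ↗.φ ↗.φ-involutive (λ _ → - 1#)

  fInverseᵀ : Fin r → Matrix (suc r)
  fInverseᵀ = ↗-Product.factor

  -- The transposed inverse factors stay in the order of `σ m`, and the product is transposed at the
  -- end. So rows and columns are exchanged: the entry at `i`, `j` is read from the chains from `j`
  -- to `i`.
  FInverse : Matrix (suc r)
  FInverse = product (map fInverseᵀ (σ m)) ᵀ

  private
    FInverse-chain : ∀ i j (ch : Chain r ↗.φ (toℕ i) r (toℕ j)) → FInverse i j ≈ (- 1#) ^ (toℕ i ∸ toℕ j)
    FInverse-chain i j ch = ≈-trans (↗-Product.chain-entry ↗.toℕ-rearranged j i ch refl refl refl) (value-sign ch)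

    FInverse-no-chain : ∀ i j → ¬ Chain r ↗.φ (toℕ i) r (toℕ j) → FInverse i j ≈ 0#
    FInverse-no-chain i j = ↗-Product.no-chain-entry ↗.toℕ-rearranged j i

    chain⇒up-edge : ∀ {i j} → toℕ j < toℕ i → Chain r ↗.φ (toℕ i) r (toℕ j) → Edge m j i
    chain⇒up-edge {i} {j} j<i ch with ↗-Edges.chain⇒link j i ch
    ... | ↗-Edges.equal refl            = contradiction j<i (ℕ.<-irrefl refl)
    ... | ↗-Edges.adjacent k refl refl  = up k
    ... | ↗-Edges.distant α β max p q s = asc α β max p q s

    -- Subtracting the inverse from `I` uses up one sign. This accounts for the exponent
    -- `toℕ b ∸ toℕ a ∸ 1` in the weight of `asc` and for the weight 1 of `up`.
    -[-1]^ : ∀ n → - ((- 1#) ^ suc n) ≈ (- 1#) ^ n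
    -[-1]^ n = ≈-trans (-‿cong (-1*x≈-x _)) (-‿involutive _)

  lower-entry : ∀ i j → toℕ j < toℕ i → transferMatrix i j ≈ - FInverse i j
  lower-entry i j j<i = transfer-entry i j (edge-weight j<i)
    λ no-edge → ≈-sym (≈-trans (-‿cong (FInverse-no-chain i j (no-edge ∘ chain⇒up-edge j<i))) -0#≈0#)
    where
    edge-weight : ∀ {i j} → toℕ j < toℕ i → (edge : Edge m j i) → weight edge ≈ - FInverse i j
    edge-weight j<i (up k) = ≈-sym (≈-trans (-‿cong (≈-trans
      (↗-Product.chain-entry ↗.toℕ-rearranged (inject₁ k) (suc k) (↗-Chains.step-chain k) (Fin.toℕ-inject₁ k) refl refl)
      (value-sign (↗-Chains.step-chain k)))) (≈-trans (≈-reflexive (cong (λ n → - ((- 1#) ^ n)) (ℕ.m+n∸n≡m 1 (toℕ k)))) (-[-1]^ 0)))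
    edge-weight j<i (down k) = contradiction (ℕ.<⇒≤ (s≤s (ℕ.≤-reflexive (Fin.toℕ-inject₁ k)))) (ℕ.<⇒≱ j<i)
    edge-weight j<i (loop i) = contradiction j<i (ℕ.<-irrefl refl)
    edge-weight j<i (desc _ _ _ _ q _) = contradiction (ℕ.<⇒≤ (ℕ.<⇒≤ q)) (ℕ.<⇒≱ j<i)
    edge-weight {i} {j} j<i (asc α β max p q s) = ≈-sym (begin
      - FInverse i j                        ≈⟨ -‿cong (FInverse-chain i j (↗-Edges.long⇒chain max p q s)) ⟩
      - ((- 1#) ^ (toℕ i ∸ toℕ j))          ≈⟨ ≈-reflexive (cong (λ n → - ((- 1#) ^ n)) suc-pred) ⟨
      - ((- 1#) ^ suc (toℕ i ∸ toℕ j ∸ 1))  ≈⟨ -[-1]^ (toℕ i ∸ toℕ j ∸ 1) ⟩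
      (- 1#) ^ (toℕ i ∸ toℕ j ∸ 1)          ∎)
      where
      suc-pred : suc (toℕ i ∸ toℕ j ∸ 1) ≡ toℕ i ∸ toℕ j
      suc-pred = ℕ.m+[n∸m]≡n (ℕ.m<n⇒0<n∸m j<i)

  FInverse-upper : ∀ i j → toℕ i ≤ toℕ j → FInverse i j ≈ I i j
  FInverse-upper i j i≤j with i Fin.≟ j
  ... | yes refl = ≈-trans (FInverse-chain i i (done refl)) (≈-reflexive (cong ((- 1#) ^_) (ℕ.n∸n≡0 (toℕ i))))
  ... | no  i≢j  = FInverse-no-chain i j λ ch → i≢j (Fin.toℕ-injective (ℕ.≤-antisym i≤j (chain-≤ ch)))

  f-elementary : ∀ k → f k ≋ elementary 1# (suc k) (inject₁ k)
  f-elementary k i j = +-congˡ (≈-sym (*-identityˡ _))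

  fInverse-elementary : ∀ k → fInverseᵀ k ᵀ ≋ elementary (- 1#) (suc k) (inject₁ k)
  fInverse-elementary k i j = +-cong (I-symmetric j i) (*-congˡ (E-transpose (inject₁ k) (suc k) j i))

  suc≢inject₁ : ∀ (k : Fin r) → suc k ≢ inject₁ k
  suc≢inject₁ k eq = ℕ.1+n≢n (trans (cong toℕ eq) (Fin.toℕ-inject₁ k))

  F-invertible : Invertible _≋_ I _⊗_ (product (map f (σ m)))
  -- `Invertible` lists the left inverse law first, `product-inverse` the right one.
  F-invertible = FInverse , proj₂ inverses , proj₁ inverses
    where
    inverses = product-inverse f fInverseᵀ
      (λ k → ≋-trans (⊗-cong (f-elementary k) (fInverse-elementary k))
        (elementary-inverse (suc≢inject₁ k) (-‿inverseʳ 1#)))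
      (λ k → ≋-trans (⊗-cong (fInverse-elementary k) (f-elementary k))
        (elementary-inverse (suc≢inject₁ k) (-‿inverseˡ 1#)))
      (σ m)

  module _ {N B : Matrix (suc r)} (N-lower : StrictlyLowerTriangular N) (B-upper : UpperTriangular B)
           (T≋N⊕B : transferMatrix ≋ N ⊕ B) where

    -- The triangular splitting is unique: below the diagonal `B` vanishes and `N` has the entry of
    -- the transfer matrix; elsewhere `N` vanishes and `FInverse` agrees with `I`.
    lower-part : N ≋ I ⊖ FInverse
    lower-part i j with ℕ.≤-<-connex (toℕ i) (toℕ j)
    ... | inj₁ i≤j = begin
      N i j                  ≈⟨ N-lower i j i≤j ⟩
      0#                     ≈⟨ -‿inverseʳ (I i j) ⟨
      I i j - I i j          ≈⟨ +-congˡ (-‿cong (FInverse-upper i j i≤j)) ⟨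
      I i j - FInverse i j   ∎
    ... | inj₂ j<i = begin
      N i j                  ≈⟨ +-identityʳ _ ⟨
      N i j ⊹ 0#             ≈⟨ +-congˡ (B-upper i j j<i) ⟨
      N i j ⊹ B i j          ≈⟨ T≋N⊕B i j ⟨
      transferMatrix i j     ≈⟨ lower-entry i j j<i ⟩
      - FInverse i j         ≈⟨ +-identityˡ _ ⟨
      0# - FInverse i j      ≈⟨ +-congʳ (I-off-diagonal λ i≡j → ℕ.<⇒≢ j<i (sym (cong toℕ i≡j))) ⟨
      I i j - FInverse i j   ∎

    upper-part : B ≋ t • (product (map d (allFin (suc r))) ⊗ eProduct)
    upper-part i j = ≈-trans (entry (ℕ.≤-<-connex (toℕ i) (toℕ j)))
      (*-congˡ (≈-sym (product-scaling-allFin (λ k → val (yOdd k)) eProduct i j)))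
      where
      entry : toℕ i ≤ toℕ j ⊎ toℕ j < toℕ i → B i j ≈ t * (val (yOdd i) * eProduct i j)
      entry (inj₁ i≤j) = begin
        B i j                              ≈⟨ +-identityˡ _ ⟨
        0# ⊹ B i j                         ≈⟨ +-congʳ (N-lower i j i≤j) ⟨
        N i j ⊹ B i j                      ≈⟨ T≋N⊕B i j ⟨
        transferMatrix i j                 ≈⟨ upper-entry i j i≤j ⟩
        t * (val (yOdd i) * eProduct i j)  ∎
      entry (inj₂ j<i) = begin
        B i j                              ≈⟨ B-upper i j j<i ⟩
        0#                                 ≈⟨ ≈-trans (*-congˡ (zeroʳ _)) (zeroʳ t) ⟨
        t * (val (yOdd i) * 0#)            ≈⟨ *-congˡ (*-congˡ (lower-eProduct i j j<i)) ⟨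
        t * (val (yOdd i) * eProduct i j)  ∎

lemma7p1 : ∀ {c ℓ₁ ℓ₂} (K : HeytingField c ℓ₁ ℓ₂) (r : ℕ) → 1 ≤ r →
    (Q : QSystem K r) (m : MotzkinPath r) (t : HeytingField.Carrier K) →
    let open Transfer K Q m t in
    (N B : Matrix (suc r)) →
    StrictlyLowerTriangular N → UpperTriangular B → transferMatrix ≋ N ⊕ B →
    (Σ (Invertible _≋_ I _⊗_ (product (map f (σ m)))) λ F⁻¹ → N ≋ I ⊖ proj₁ F⁻¹) ×
    (B ≋ t • (product (map d (allFin (suc r))) ⊗ product (map e (τ m))))
lemma7p1 K r _ Q m t N B N-lower B-upper T≋N⊕B =
  (F-invertible , lower-part N-lower B-upper T≋N⊕B) , upper-part N-lower B-upper T≋N⊕B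
  where open Entries K Q m t
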